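{- Let $q=2^e$ with $q>2$, $A=\mathbb{F}_q[T]$, and let $C$ be the Carlitz module. Let $m,u\in A$ be monic polynomials such that at least one of them has positive degree. Then there exists a Zsigmondy prime for $(u,m)$, except exactly in the following case: $q=4$, $u=1$, and $m=(\wp-1)\wp$, where $\wp$ is an arbitrary monic prime of degree $1$ in $\mathbb{F}_4[T]$.
   Context: $A=\mathbb{F}_q[T]$, $k=\mathbb{F}_q(T)$. The Carlitz module is the $\mathbb{F}_q$-algebra homomorphism $a\mapsto C_a$ from $A$ to the twisted polynomial ring $k\langle\tau\rangle$ (with $\tau(x)=x^q$) determined by $C_T=T+\tau$; thus $C_T(x)=Tx+x^q$ and $C_a(x)\in A[x]$ for every $a\in A$, with $C_{ab}(x)=C_a(C_b(x))$. For nonzero $m,u\in A$, a Zsigmondy prime for $(u,m)$ is a monic prime $\wp\in A$ such that $C_m(u)\equiv 0\pmod{\wp}$ and $C_n(u)\not\equiv 0\pmod{\wp}$ for every nonzero $n\in A$ with $\deg(n)<\deg(m)$. -}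

module Defs where

open import Level using (0ℓ)
open import Data.Nat as ℕ using (ℕ; zero; suc)
open import Data.Fin using (Fin)
open import Data.List using (List; []; _∷_; length)
open import Data.Product using (Σ; _×_; _,_; ∃)
open import Data.Sum using (_⊎_)
open import Relation.Nullary using (¬_)
open import Relation.Binary.PropositionalEquality using (_≡_; _≢_)
open import Algebra.Structures using (IsCommutativeRing)
open import Function.Bundles using (_↔_)

record FiniteField (q : ℕ) : Set₁ where
  infixl 7 _*_
  infixl 6 _+_
  field
    Carrier : Set
    _+_ _*_ : Carrier → Carrier → Carrier
    -_      : Carrier → Carrier
    0# 1#   : Carrier
    isCommutativeRing : IsCommutativeRing _≡_ _+_ _*_ -_ 0# 1#
    0≢1     : 0# ≢ 1#
    inverse : ∀ x → x ≢ 0# → Σ Carrier (λ y → x * y ≡ 1#)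
    card    : Carrier ↔ Fin q

-- Polynomials A = F[T] over a finite field, as coefficient lists
-- (lowest degree first); equality is coefficientwise (so trailing
-- zeros are irrelevant).
module Poly {q : ℕ} (F : FiniteField q) where
  open FiniteField F renaming (_+_ to _+F_; _*_ to _*F_; -_ to -F_)

  Pol : Set
  Pol = List Carrier

  coeff : Pol → ℕ → Carrier
  coeff []       _       = 0#
  coeff (a ∷ p)  zero    = a
  coeff (a ∷ p)  (suc i) = coeff p i

  infix 4 _≈_
  _≈_ : Pol → Pol → Set
  p ≈ r = ∀ i → coeff p i ≡ coeff r i

  infixl 6 _+_ _-_
  infixl 7 _*_ _·_

  _+_ : Pol → Pol → Pol
  []      + r       = r
  (a ∷ p) + []      = a ∷ p
  (a ∷ p) + (b ∷ r) = (a +F b) ∷ (p + r)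

  _·_ : Carrier → Pol → Pol
  c · []      = []
  c · (a ∷ p) = (c *F a) ∷ (c · p)

  neg : Pol → Pol
  neg p = (-F 1#) · p

  _-_ : Pol → Pol → Pol
  p - r = p + neg r

  _*_ : Pol → Pol → Pol
  []      * r = []
  (a ∷ p) * r = (a · r) + (0# ∷ (p * r))

  const : Carrier → Pol
  const c = c ∷ []

  one : Pol
  one = const 1#

  T : Pol
  T = 0# ∷ 1# ∷ []

  _^_ : Pol → ℕ → Pol
  p ^ zero  = one
  p ^ suc n = p * (p ^ n)

  HasDegree : Pol → ℕ → Set
  HasDegree p d = (coeff p d ≢ 0#) × (∀ i → d ℕ.< i → coeff p i ≡ 0#)

  Monic : Pol → ℕ → Set
  Monic p d = HasDegree p d × (coeff p d ≡ 1#)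

  infix 4 _∣_
  _∣_ : Pol → Pol → Set
  a ∣ b = Σ Pol (λ c → b ≈ a * c)

  IsUnit : Pol → Set
  IsUnit a = Σ Pol (λ v → a * v ≈ one)

  MonicPrime : Pol → Set
  MonicPrime p = Σ ℕ (λ d → Monic p d × (0 ℕ.< d))
               × (∀ a b → p ∣ a * b → (p ∣ a) ⊎ (p ∣ b))

  -- Carlitz module: C_T(x) = T x + x^q, and for a = Σ aᵢ Tⁱ,
  -- C_a = Σ aᵢ (C_T)ⁱ  (the unique F_q-algebra hom with C_T = T + τ).
  CT : Pol → Pol
  CT x = (T * x) + (x ^ q)

  CTiter : ℕ → Pol → Pol
  CTiter zero    x = x
  CTiter (suc n) x = CT (CTiter n x)

  carlitzFrom : ℕ → Pol → Pol → Pol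
  carlitzFrom i []      x = []
  carlitzFrom i (a ∷ m) x = (a · CTiter i x) + carlitzFrom (suc i) m x

  C : Pol → Pol → Pol
  C m x = carlitzFrom 0 m x

  -- Zsigmondy prime for (u, m), where m has degree dm
  Zsigmondy : Pol → Pol → ℕ → Pol → Set
  Zsigmondy u m dm ℘ =
    MonicPrime ℘ × (℘ ∣ C m u)
    × (∀ n d → HasDegree n d → d ℕ.< dm → ¬ (℘ ∣ C n u))

{-# OPTIONS --safe #-}
-- Write c(n) = C_n(u) and let S be the set of monic primes dividing m. From C_a(x) = x (a + x² h) the sequence c is
-- a strong divisibility sequence, so the least common multiple L of the c(m/p), p ∈ S, has degree given by
-- inclusion-exclusion over S, and c(m) = L R with deg R of the size of φ(m) deg u (of φ(m) / q when
-- u = 1). For each p ∈ S the quotient R divides C_p(x)/x = p + x² h with x = c(m/p). Hence a prime divisor of R is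
-- either a Zsigmondy prime, or is some p ∈ S that divides c(m/p) and divides R only once; so a Zsigmondy prime exists
-- as soon as deg R exceeds the sum of the degrees of these p. Counting degrees, the bound over all of S fails only for
-- u = 1 with m a linear prime, where c(m/p) = 1, and for u = 1, q = 4 with m = p₁ p₂ a product of two linear primes,
-- where p₁ divides c(p₂) = p₂ + 1 only in the exceptional case p₁ = p₂ + 1.
module Submission where

open import Defs
open import Level using (0ℓ)
open import Algebra.Bundles using (CommutativeRing; CommutativeMonoid)
open import Algebra.Structures using (IsCommutativeRing)
import Algebra.Solver.Ring
open import Algebra.Solver.Ring.AlmostCommutativeRing using (fromCommutativeRing; _-Raw-AlmostCommutative⟶_)
open import Data.Bool using (Bool; true; false)
import Data.Bool.Properties as Boolₚ
open import Data.Empty using (⊥; ⊥-elim)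
open import Data.Fin using (Fin)
import Data.Fin.Permutation as Perm
import Data.Fin.Properties as Finₚ
open import Data.List using (List; []; _∷_; foldr)
open import Data.List.Relation.Unary.All as All using (All; []; _∷_)
open import Data.List.Relation.Unary.All.Properties using (¬Any⇒All¬)
open import Data.List.Relation.Unary.AllPairs using (AllPairs; []; _∷_)
open import Data.List.Relation.Unary.Any as Any using (Any; here; there)
open import Data.Maybe using (Maybe; just; nothing)
open import Data.Nat as ℕ using (ℕ; zero; suc; _<_; _≤_; s≤s; z≤n)
import Data.Nat.Properties as ℕₚ
open import Data.Nat.Solver using (module +-*-Solver)
open import Data.Product using (Σ; _×_; _,_; ∃; ∃₂; proj₁; proj₂)
open import Data.Sum using (_⊎_; inj₁; inj₂; [_,_]′)
open import Data.Unit using (⊤; tt)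
open import Function using (_∘_)
open import Function.Bundles using (_↔_; Inverse; mk↔ₛ′; _⇔_; mk⇔)
open import Function.Properties.Inverse using (Inverse⇒Injection; ↔-sym; ↔-trans)
open import Relation.Binary.Bundles using (Setoid)
open import Relation.Binary.Definitions using (DecidableEquality)
open import Relation.Nullary using (¬_; Dec; yes; no)
open import Relation.Nullary.Decidable using (via-injection; map′; _×-dec_)

-- The factor x² is where q > 2 enters: it comes from x³ dividing x^q. If p divides x, then p + x² h
-- is congruent to p modulo p², which is why p can divide R only once. The least common multiple is
-- assembled from Bezout relations, adjoining one c(m/p) at a time. Each adjunction divides the
-- current quotient by the quotient belonging to a smaller argument; on degrees, inclusion-exclusion
-- thus becomes repeated subtraction. If deg C_n(u) = q^(deg n) deg u, the outcome is a product with
-- one factor q^(deg p) - 1 for each prime p. For u = 1 the degree is q^(deg n - 1), except at deg n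
-- = 0, where it is 0 instead of 1/q. This single defect causes the deviation μ(m)/q from φ(m)/q. It
-- is visible only when the part of m outside the product of its primes is constant, so only
-- square-free m need care. In characteristic 2 signs disappear and p - 1 = p + 1, so the
-- exceptional m is symmetric in p and p + 1.

HasCharacteristic2 : CommutativeRing 0ℓ 0ℓ → Set
HasCharacteristic2 R = 1# + 1# ≈ 0#
  where open CommutativeRing R

-- With coefficients in 𝔽₂ the solver also cancels x + x and knows that - x = x.
module Char2Solver (R : CommutativeRing 0ℓ 0ℓ) (1+1≈0 : HasCharacteristic2 R) where
  open CommutativeRing R
  open import Algebra.Properties.AbelianGroup +-abelianGroup using (ε⁻¹≈ε; inverseˡ-unique)

  ⟦_⟧₂ : Bool → Carrier
  ⟦ true ⟧₂  = 1#
  ⟦ false ⟧₂ = 0#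

  morphism : CommutativeRing.rawRing Boolₚ.xor-∧-commutativeRing -Raw-AlmostCommutative⟶ fromCommutativeRing R
  morphism = record
    { ⟦_⟧    = ⟦_⟧₂
    ; +-homo = λ { true true → sym 1+1≈0 ; true false → sym (+-identityʳ 1#)
                 ; false true → sym (+-identityˡ 1#) ; false false → sym (+-identityʳ 0#) }
    ; *-homo = λ { true true → sym (*-identityˡ 1#) ; true false → sym (zeroʳ 1#)
                 ; false true → sym (zeroˡ 1#) ; false false → sym (zeroˡ 0#) }
    ; -‿homo = λ { true → inverseˡ-unique 1# 1# 1+1≈0 ; false → sym ε⁻¹≈ε }
    ; 0-homo = refl
    ; 1-homo = refl
    }

  _≟₂_ : ∀ a b → Maybe (⟦ a ⟧₂ ≈ ⟦ b ⟧₂)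
  true  ≟₂ true  = just refl
  false ≟₂ false = just refl
  _     ≟₂ _     = nothing

  open Algebra.Solver.Ring _ _ morphism _≟₂_ public
    using (solve; _:=_; _:+_; _:*_; :-_; con; Polynomial)

-- Divisibility and strong divisibility sequences in characteristic 2.

module Divisibility (R : CommutativeRing 0ℓ 0ℓ) (1+1≈0 : HasCharacteristic2 R) where
  open CommutativeRing R public
  open Char2Solver R 1+1≈0 public
  open import Relation.Binary.Reasoning.Setoid setoid public

  :1 : ∀ {n} → Polynomial n
  :1 = con true

  :0 : ∀ {n} → Polynomial n
  :0 = con false

  infix 4 _∣_
  record _∣_ (a b : Carrier) : Set where
    constructor _,_
    field
      quotient : Carrier
      equality : b ≈ a * quotient
  open _∣_ public

  ∣-refl : ∀ {a} → a ∣ a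
  ∣-refl {a} = 1# , sym (*-identityʳ a)

  ∣-trans : ∀ {a b c} → a ∣ b → b ∣ c → a ∣ c
  ∣-trans (x , e) (y , e′) = x * y , trans e′ (trans (*-congʳ e) (*-assoc _ x y))

  ∣-respʳ : ∀ {a b b′} → b ≈ b′ → a ∣ b → a ∣ b′
  ∣-respʳ e (x , e′) = x , trans (sym e) e′

  ∣-respˡ : ∀ {a a′ b} → a ≈ a′ → a ∣ b → a′ ∣ b
  ∣-respˡ e (x , e′) = x , trans e′ (*-congʳ e)

  ∣-* : ∀ {a b} c → a ∣ b → a ∣ b * c
  ∣-* c (x , e) = x * c , trans (*-congʳ e) (*-assoc _ x c)

  ∣-+ : ∀ {a b c} → a ∣ b → a ∣ c → a ∣ b + c
  ∣-+ {a} (x , e) (y , e′) = x + y , trans (+-cong e e′) (sym (distribˡ a x y))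

  ∣-+-cancelʳ : ∀ {a b c} → a ∣ b + c → a ∣ c → a ∣ b
  ∣-+-cancelʳ {a} {b} {c} d d′ = ∣-respʳ (solve 2 (λ b c → (b :+ c) :+ c := b) refl b c) (∣-+ d d′)

  Coprime : Carrier → Carrier → Set
  Coprime a b = ∃₂ λ α β → α * a + β * b ≈ 1#

  Coprime-sym : ∀ {a b} → Coprime a b → Coprime b a
  Coprime-sym (α , β , e) = β , α , trans (+-comm _ _) e

  -- A greatest common divisor d together with a unimodular cofactor row, so that a = b = 0 is no exception.
  record Bezout (a b : Carrier) : Set where
    field
      d a′ b′ σ ρ : Carrier
      a≈da′ : a ≈ d * a′
      b≈db′ : b ≈ d * b′
      unimodular : σ * a′ + ρ * b′ ≈ 1#

    combination : d ≈ σ * a + ρ * b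
    combination = begin
      d                                ≈⟨ *-identityʳ d ⟨
      d * 1#                           ≈⟨ *-congˡ unimodular ⟨
      d * (σ * a′ + ρ * b′)
        ≈⟨ solve 5 (λ d σ a ρ b → d :* (σ :* a :+ ρ :* b) := σ :* (d :* a) :+ ρ :* (d :* b)) refl d σ a′ ρ b′ ⟩
      σ * (d * a′) + ρ * (d * b′)      ≈⟨ +-cong (*-congˡ a≈da′) (*-congˡ b≈db′) ⟨
      σ * a + ρ * b                    ∎

  ∏ : List Carrier → Carrier
  ∏ = foldr _*_ 1#

  -- The hypotheses say that c is a strong divisibility sequence, as n ↦ C_n(u) is; the least common multiple
  -- of the c (m / s), s ranging over the primes of m, is then found by inclusion-exclusion.
  module CommonMultiples
    (bezout : ∀ a b → Bezout a b)
    (c : Carrier → Carrier) (c-cong : ∀ {m n} → m ≈ n → c m ≈ c n)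
    (c-∣ : ∀ n k → c n ∣ c (n * k))
    (c-coprime : ∀ n {a b} → Coprime a b → ∃₂ λ α β → c n ≈ α * c (n * a) + β * c (n * b))
    where

    -- z is a common multiple of the c (m / s), s ∈ S, where m = k * ∏ S.
    CM : Carrier → List Carrier → Carrier → Set
    CM k []      z = ⊤
    CM k (s ∷ S) z = c (k * ∏ S) ∣ z × CM (k * s) S z

    CM-cong : ∀ S {k k′ z} → k ≈ k′ → CM k S z → CM k′ S z
    CM-cong []      e _        = tt
    CM-cong (s ∷ S) e (d , cm) = ∣-respˡ (c-cong (*-congʳ e)) d , CM-cong S (*-congʳ e) cm

    CM-∣ : ∀ S {k z z′} → z ∣ z′ → CM k S z → CM k S z′
    CM-∣ []      z∣z′ _        = tt
    CM-∣ (s ∷ S) z∣z′ (d , cm) = ∣-trans d z∣z′ , CM-∣ S z∣z′ cm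

    swapʳ : ∀ a b d → (a * b) * d ≈ (a * d) * b
    swapʳ = solve 3 (λ a b d → (a :* b) :* d := (a :* d) :* b) refl

    CM-shrink : ∀ S {k p z} → CM (k * p) S z → CM k S z
    CM-shrink []      _ = tt
    CM-shrink (s ∷ S) {k} {p} (d , cm) =
      ∣-trans (∣-respʳ (c-cong (swapʳ k (∏ S) p)) (c-∣ _ p)) d ,
      CM-shrink S (CM-cong S (swapʳ k p s) cm)

    -- Unrolls the recursion of `CM`: when `s` is reached, the accumulated `k` times the remaining
    -- product is m / s.
    CM-factors : ∀ S {k z} → CM k S z → All (λ p → ∃ λ n → n * p ≈ k * ∏ S × c n ∣ z) S
    CM-factors []      _ = []
    CM-factors (s ∷ S) {k} (d , cm) =
      (k * ∏ S , solve 3 (λ k s P → (k :* P) :* s := k :* (s :* P)) refl k s (∏ S) , d) ∷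
      All.map (λ (n , e , d′) → n , trans e (*-assoc k s (∏ S)) , d′) (CM-factors S cm)

    -- In terms of ideals this is the distributivity of gcd over lcm.
    CM-decompose : ∀ S {k p z} → All (Coprime p) S → CM k S z →
      ∃₂ λ α w → z ≈ α * c (k * ∏ S) + w × CM (k * p) S w
    CM-decompose [] {k} {p} {z} _ _ =
      0# , z , solve 2 (λ z a → z := :0 :* a :+ z) refl z _ , tt
    CM-decompose (s ∷ S) {k} {p} {z} (ps ∷ pS) ((x , z≈) , cm)
      with CM-decompose S pS cm | c-coprime (k * ∏ S) (Coprime-sym ps)
    ... | α , w , z≈αa+w , cmw | α′ , β′ , c≈ = σ * b′ * α + ρ * w′ * α′ * x , d * b′ * (w′ * (σ + ρ * β)) , split ,
        (w′ * (σ + ρ * β) , *-congʳ (sym b≈db′)) ,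
        CM-∣ S (b′ * (σ + ρ * β) , w∣) (CM-cong S (swapʳ k s p) cmw)
      where
      a b β : Carrier
      a = c (k * (s * ∏ S))
      b = c ((k * p) * ∏ S)
      β = β′ * x
      open Bezout (bezout b w) renaming (a≈da′ to b≈db′; b≈db′ to w≈dw′; a′ to b′; b′ to w′)

      w∣ : d * b′ * (w′ * (σ + ρ * β)) ≈ w * (b′ * (σ + ρ * β))
      w∣ = trans (solve 4 (λ d b w t → d :* b :* (w :* t) := d :* w :* (b :* t)) refl d b′ w′ _) (*-congʳ (sym w≈dw′))

      -- Modulo `a`, `z` is a multiple of `w` by induction (`z₁`) and of `b` by `c-coprime` (`z₂`).
      -- Weighting the two expressions by `σ * b′` and `ρ * w′`, which sum to 1, turns both
      -- remainders into multiples of `d * b′ * w′`, the least common multiple of `b` and `w`.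
      z₁ : z ≈ α * a + d * w′
      z₁ = trans z≈αa+w (+-cong (*-congˡ (c-cong (*-assoc k s _))) w≈dw′)

      z₂ : z ≈ α′ * x * a + d * b′ * β
      z₂ = begin
        z                                           ≈⟨ z≈ ⟩
        c (k * ∏ S) * x                             ≈⟨ *-congʳ c≈ ⟩
        (α′ * c (k * ∏ S * s) + β′ * c (k * ∏ S * p)) * x
          ≈⟨ *-congʳ (+-cong (*-congˡ (c-cong (trans (swapʳ k _ s) (*-assoc k s _)))) (*-congˡ (c-cong (swapʳ k _ p)))) ⟩
        (α′ * a + β′ * b) * x                       ≈⟨ *-congʳ (+-congˡ (*-congˡ b≈db′)) ⟩
        (α′ * a + β′ * (d * b′)) * x
          ≈⟨ solve 6 (λ α a β d b x → (α :* a :+ β :* (d :* b)) :* x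
                 := α :* x :* a :+ d :* b :* (β :* x)) refl α′ a β′ d b′ x ⟩
        α′ * x * a + d * b′ * β                     ∎

      split : z ≈ (σ * b′ * α + ρ * w′ * α′ * x) * a + d * b′ * (w′ * (σ + ρ * β))
      split = begin
        z                                                  ≈⟨ *-identityˡ z ⟨
        1# * z                                             ≈⟨ *-congʳ unimodular ⟨
        (σ * b′ + ρ * w′) * z                              ≈⟨ distribʳ z _ _ ⟩
        σ * b′ * z + ρ * w′ * z                            ≈⟨ +-cong (*-congˡ z₁) (*-congˡ z₂) ⟩
        σ * b′ * (α * a + d * w′) + ρ * w′ * (α′ * x * a + d * b′ * β)
          ≈⟨ solve 10 (λ σ b α a d w ρ α′ x β →
               σ :* b :* (α :* a :+ d :* w) :+ ρ :* w :* (α′ :* x :* a :+ d :* b :* β)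
               := (σ :* b :* α :+ ρ :* w :* α′ :* x) :* a :+ d :* b :* (w :* (σ :+ ρ :* β)))
             refl σ b′ α a d w′ ρ α′ x β ⟩
        (σ * b′ * α + ρ * w′ * α′ * x) * a + d * b′ * (w′ * (σ + ρ * β)) ∎

    -- The complementary factor `R′` is carried along because it, rather than `L`, obeys the simple
    -- recursion of `LCM-∷`; it is the primitive part whose degree is wanted.
    record LCM (k : Carrier) (S : List Carrier) : Set where
      field
        L R′ : Carrier
        common : CM k S L
        least  : ∀ {z} → CM k S z → L ∣ z
        factorization : c (k * ∏ S) ≈ L * R′

    module _ (cancelˡ : ∀ {a x y} → ¬ a ≈ 0# → a * x ≈ a * y → x ≈ y) where

      LCM-[] : ∀ k → LCM k []
      LCM-[] k = record
        { L = 1# ; R′ = c (k * 1#) ; common = tt ; least = λ {z} _ → z , sym (*-identityˡ z)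
        ; factorization = sym (*-identityˡ _) }

      -- Adjoining a = `c (k * ∏ S)` to the multiples collected in `B`: by `CM-decompose` the ideal
      -- generated by a and `B.L` is that of `A.L`. As a = `A.L * A.R′`, the new least common
      -- multiple is `B.L * A.R′`, and the new quotient is `B.R′` divided by `A.R′`. This is one
      -- step of inclusion-exclusion.
      LCM-∷ : ∀ {k s S} → ¬ c (k * ∏ S) ≈ 0# → All (Coprime s) S →
        (A : LCM k S) (B : LCM (k * s) S) → Σ (LCM k (s ∷ S)) λ A′ → LCM.R′ B ≈ LCM.R′ A * LCM.R′ A′
      LCM-∷ {k} {s} {S} a≉0 s⊥S A B with CM-decompose S s⊥S A.common
        where module A = LCM A
      ... | α , w , g≈ , cmw = record
          { L = B.L * A.R′ ; R′ = Q
          ; common = (h , L≈ah) , CM-∣ S (A.R′ , refl) B.common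
          ; least = λ { ((z₁ , e₁) , cm) → least′ e₁ (B.least cm) }
          ; factorization = trans (trans (c-cong (sym (*-assoc k s _))) B.factorization)
              (trans (*-congˡ R₂≈) (sym (*-assoc _ _ _))) } , R₂≈
        where
        module A = LCM A
        module B = LCM B
        a h y : Carrier
        a = c (k * ∏ S)
        h = quotient (A.least (CM-shrink S B.common))
        y = quotient (B.least cmw)

        B≈ : B.L ≈ A.L * h
        B≈ = equality (A.least (CM-shrink S B.common))

        A≉0 : ¬ A.L ≈ 0#
        A≉0 e = a≉0 (trans A.factorization (trans (*-congʳ e) (zeroˡ _)))

        -- The relation `g≈` divided by `A.L`: the cofactors `A.R′` of `a` and `h` of `B.L` are
        -- coprime.
        unit : α * A.R′ + h * y ≈ 1#
        unit = cancelˡ A≉0 (begin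
          A.L * (α * A.R′ + h * y)
            ≈⟨ solve 5 (λ g α r h y → g :* (α :* r :+ h :* y) := α :* (g :* r) :+ g :* h :* y) refl A.L α A.R′ h y ⟩
          α * (A.L * A.R′) + A.L * h * y    ≈⟨ +-cong (*-congˡ A.factorization) (*-congʳ B≈) ⟨
          α * a + B.L * y                   ≈⟨ +-congˡ (equality (B.least cmw)) ⟨
          α * a + w                         ≈⟨ g≈ ⟨
          A.L                               ≈⟨ *-identityʳ _ ⟨
          A.L * 1#                          ∎)

        t : Carrier
        t = quotient (c-∣ (k * ∏ S) s)

        hR₂≈ : h * B.R′ ≈ A.R′ * t
        hR₂≈ = cancelˡ A≉0 (begin
          A.L * (h * B.R′)    ≈⟨ *-assoc _ _ _ ⟨
          A.L * h * B.R′      ≈⟨ *-congʳ B≈ ⟨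
          B.L * B.R′          ≈⟨ B.factorization ⟨
          c (k * s * ∏ S)     ≈⟨ c-cong (swapʳ k s _) ⟩
          c (k * ∏ S * s)     ≈⟨ equality (c-∣ (k * ∏ S) s) ⟩
          a * t               ≈⟨ *-congʳ A.factorization ⟩
          A.L * A.R′ * t      ≈⟨ *-assoc _ _ _ ⟩
          A.L * (A.R′ * t)    ∎)

        -- By `hR₂≈`, `A.R′` divides `h * B.R′`; being coprime to `h`, it divides `B.R′`, and `unit`
        -- gives this quotient.
        Q : Carrier
        Q = α * B.R′ + y * t

        R₂≈ : B.R′ ≈ A.R′ * Q
        R₂≈ = begin
          B.R′                                ≈⟨ *-identityˡ _ ⟨
          1# * B.R′                           ≈⟨ *-congʳ unit ⟨
          (α * A.R′ + h * y) * B.R′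
            ≈⟨ solve 5 (λ α r h y r₂ → (α :* r :+ h :* y) :* r₂
                   := r :* (α :* r₂) :+ y :* (h :* r₂)) refl α A.R′ h y B.R′ ⟩
          A.R′ * (α * B.R′) + y * (h * B.R′)  ≈⟨ +-congˡ (*-congˡ hR₂≈) ⟩
          A.R′ * (α * B.R′) + y * (A.R′ * t)
            ≈⟨ solve 4 (λ r x y t → r :* x :+ y :* (r :* t) := r :* (x :+ y :* t)) refl A.R′ (α * B.R′) y t ⟩
          A.R′ * Q                            ∎

        L≈ah : B.L * A.R′ ≈ a * h
        L≈ah = trans (*-congʳ B≈) (trans (swapʳ _ _ _) (*-congʳ (sym A.factorization)))

        least′ : ∀ {z z₁} → z ≈ a * z₁ → B.L ∣ z → B.L * A.R′ ∣ z
        least′ {z} {z₁} e₁ (z₂ , e₂) = α * z₂ + y * z₁ , (begin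
          z                                       ≈⟨ *-identityˡ z ⟨
          1# * z                                  ≈⟨ *-congʳ unit ⟨
          (α * A.R′ + h * y) * z                  ≈⟨ distribʳ z _ _ ⟩
          α * A.R′ * z + h * y * z                ≈⟨ +-cong (*-congˡ e₂) (*-congˡ e₁) ⟩
          α * A.R′ * (B.L * z₂) + h * y * (a * z₁)
            ≈⟨ solve 8 (λ α r b z₂ h y a z₁ → α :* r :* (b :* z₂) :+ h :* y :* (a :* z₁)
                          := b :* r :* (α :* z₂) :+ a :* h :* (y :* z₁)) refl α A.R′ B.L z₂ h y a z₁ ⟩
          B.L * A.R′ * (α * z₂) + a * h * (y * z₁)        ≈⟨ +-congˡ (*-congʳ L≈ah) ⟨
          B.L * A.R′ * (α * z₂) + B.L * A.R′ * (y * z₁)   ≈⟨ distribˡ _ _ _ ⟨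
          B.L * A.R′ * (α * z₂ + y * z₁)                  ∎)

open import Relation.Binary.PropositionalEquality

-- Finite fields: the characteristic and Fermat's identity.

module FieldTheory {q : ℕ} (F : FiniteField q) where
  open FiniteField F

  ring : CommutativeRing 0ℓ 0ℓ
  ring = record { isCommutativeRing = isCommutativeRing }

  open CommutativeRing ring public
    using (+-assoc; +-comm; +-identityˡ; +-identityʳ; -‿inverseʳ; -‿inverseˡ;
           *-assoc; *-comm; *-identityˡ; *-identityʳ; distribˡ; distribʳ; zeroˡ; zeroʳ;
           semiring; +-commutativeMonoid; *-commutativeMonoid)
  open import Algebra.Properties.Ring (CommutativeRing.ring ring) public
    using (-1*x≈-x)
  open import Algebra.Properties.Semiring.Exp semiring public
    using () renaming (_^_ to _^F_)
  open import Algebra.Properties.Semiring.Mult semiring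
    using (×1-homo-*) renaming (_×_ to _·ℕ_)

  infix 4 _≟_
  _≟_ : DecidableEquality Carrier
  _≟_ = via-injection (Inverse⇒Injection card) Finₚ._≟_

  any-field? : {P : Carrier → Set} → (∀ x → Dec (P x)) → Dec (∃ P)
  any-field? {P} P? = map′
    (λ (i , p) → Inverse.from card i , p)
    (λ (x , p) → Inverse.to card x , subst P (sym (Inverse.strictlyInverseʳ card x)) p)
    (Finₚ.any? (λ i → P? (Inverse.from card i)))

  -- Reindexing a sum over F by a bijection is the source of both q · 1 = 0 and c ^ q = c.
  module Reindex (+-law : CommutativeMonoid 0ℓ 0ℓ)  where
    open CommutativeMonoid +-law using (_≈_) renaming (Carrier to M; trans to ≈-trans; reflexive to ≈-reflexive)
    open import Algebra.Properties.CommutativeMonoid.Sum +-law public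
      using (sum; sum-permute; sum-cong-≗; sum-replicate; ∑-distrib-+)

    total : (Carrier → M) → M
    total g = sum (λ i → g (Inverse.from card i))

    total-reindex : (f : Carrier ↔ Carrier) (g : Carrier → M) → total g ≈ total (λ x → g (Inverse.to f x))
    total-reindex f g = ≈-trans (sum-permute _ π)
      (≈-reflexive (sum-cong-≗ {q} (λ i → cong g (Inverse.strictlyInverseʳ card (Inverse.to f (Inverse.from card i))))))
      where
      π : Perm.Permutation q q
      π = ↔-trans (↔-sym card) (↔-trans f card)

  +-cancelˡ : ∀ {x y} → x ≡ x + y → y ≡ 0#
  +-cancelˡ {x} {y} eq = begin
    y               ≡⟨ +-identityˡ y ⟨
    0# + y          ≡⟨ cong (_+ y) (-‿inverseˡ x) ⟨
    (- x + x) + y   ≡⟨ +-assoc _ _ _ ⟩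
    - x + (x + y)   ≡⟨ cong (- x +_) eq ⟨
    - x + x         ≡⟨ -‿inverseˡ x ⟩
    0#              ∎
    where open ≡-Reasoning

  *-cancelˡ : ∀ {x y z} → x ≢ 0# → x * y ≡ x * z → y ≡ z
  *-cancelˡ {x} {y} {z} x≢0 eq = trans (sym (undo y)) (trans (cong (proj₁ (inverse x x≢0) *_) eq) (undo z))
    where
    undo : ∀ t → proj₁ (inverse x x≢0) * (x * t) ≡ t
    undo t = trans (sym (*-assoc _ _ _))
      (trans (cong (_* t) (trans (*-comm _ x) (proj₂ (inverse x x≢0)))) (*-identityˡ t))

  integral : ∀ {x y} → x * y ≡ 0# → x ≢ 0# → y ≡ 0#
  integral {x} {y} eq x≢0 = *-cancelˡ x≢0 (trans eq (sym (zeroʳ x)))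

  *-≢0 : ∀ {x y} → x ≢ 0# → y ≢ 0# → x * y ≢ 0#
  *-≢0 x≢0 y≢0 eq = y≢0 (integral eq x≢0)

  -- The shift by 1 permutes the field, so the sum of all elements equals itself plus q times 1.
  q·1≡0 : q ·ℕ 1# ≡ 0#
  q·1≡0 = trans (sym (sum-replicate q)) (+-cancelˡ
    (trans (total-reindex shift (λ x → x)) (∑-distrib-+ {q} _ _)))
    where
    open Reindex +-commutativeMonoid
    shift : Carrier ↔ Carrier
    shift = mk↔ₛ′ (_+ 1#) (_+ - 1#)
      (λ x → trans (+-assoc x _ _) (trans (cong (x +_) (-‿inverseˡ 1#)) (+-identityʳ x)))
      (λ x → trans (+-assoc x _ _) (trans (cong (x +_) (-‿inverseʳ 1#)) (+-identityʳ x)))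

  -- A nonzero 1 + 1 could be cancelled from 2^e times 1, one factor at a time, down to 1 = 0.
  2^e·1≡0⇒1+1≡0 : ∀ e → (2 ℕ.^ e) ·ℕ 1# ≡ 0# → 1# + 1# ≡ 0#
  2^e·1≡0⇒1+1≡0 zero    eq = ⊥-elim (0≢1 (trans (sym eq) (+-identityʳ 1#)))
  2^e·1≡0⇒1+1≡0 (suc e) eq with 1# + 1# ≟ 0#
  ... | yes eq₂ = eq₂
  ... | no  ne₂ = 2^e·1≡0⇒1+1≡0 e (integral
    (trans (cong (_* ((2 ℕ.^ e) ·ℕ 1#)) (cong (1# +_) (sym (+-identityʳ 1#)))) (trans (sym (×1-homo-* 2 (2 ℕ.^ e))) eq)) ne₂)

  char2 : ∀ e → q ≡ 2 ℕ.^ e → 1# + 1# ≡ 0#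
  char2 e refl = 2^e·1≡0⇒1+1≡0 e q·1≡0

  private
    -- Replacing 0 by 1 makes the product over F invertible.
    unitPart : Carrier → Carrier
    unitPart x with x ≟ 0#
    ... | yes _ = 1#
    ... | no  _ = x

    unitPart≢0 : ∀ x → unitPart x ≢ 0#
    unitPart≢0 x with x ≟ 0#
    ... | yes _ = 0≢1 ∘ sym
    ... | no x≢0 = x≢0

    scalePart : Carrier → Carrier → Carrier
    scalePart c x with x ≟ 0#
    ... | yes _ = 1#
    ... | no  _ = c

    unitPart-scale : ∀ {c} → c ≢ 0# → ∀ x → unitPart (c * x) ≡ scalePart c x * unitPart x
    unitPart-scale {c} c≢0 x with x ≟ 0# | c * x ≟ 0#
    ... | yes _   | yes _   = sym (*-identityˡ 1#)
    ... | yes x≡0 | no  ne  = ⊥-elim (ne (trans (cong (c *_) x≡0) (zeroʳ c)))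
    ... | no  x≢0 | yes eq  = ⊥-elim (*-≢0 c≢0 x≢0 eq)
    ... | no  _   | no  _   = refl

    module Product = Reindex *-commutativeMonoid

    product-≢0 : ∀ {n} (f : Fin n → Carrier) → (∀ i → f i ≢ 0#) → Product.sum f ≢ 0#
    product-≢0 {zero}  f f≢0 = 0≢1 ∘ sym
    product-≢0 {suc n} f f≢0 = *-≢0 (f≢0 Fin.zero) (product-≢0 (f ∘ Fin.suc) (f≢0 ∘ Fin.suc))

    -- The factor missing at the exceptional index is supplied from outside, so the exponent is `n`
    -- itself and not its predecessor.
    product-const-except : ∀ {n} (f : Fin n → Carrier) c (i : Fin n) → f i ≡ 1# → (∀ j → j ≢ i → f j ≡ c) →
      c * Product.sum f ≡ c ^F n
    product-const-except {suc n} f c Fin.zero f₀ f₁ = cong (c *_)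
      (trans (cong₂ _*_ f₀ (trans (Product.sum-cong-≗ (λ j → f₁ (Fin.suc j) (λ ())))
                                  (Product.sum-replicate n)))
             (*-identityˡ _))
    product-const-except {suc n} f c (Fin.suc i) f₀ f₁ = begin
      c * (f Fin.zero * Product.sum (f ∘ Fin.suc)) ≡⟨ cong (λ t → c * (t * _)) (f₁ Fin.zero (λ ())) ⟩
      c * (c * Product.sum (f ∘ Fin.suc))
        ≡⟨ cong (c *_) (product-const-except (f ∘ Fin.suc) c i f₀ (λ j j≢i → f₁ (Fin.suc j) (j≢i ∘ Finₚ.suc-injective))) ⟩
      c * c ^F n                                    ∎
      where open ≡-Reasoning

  -- For c ≠ 0, multiplication by c permutes the field. The invertible product of all `unitPart`
  -- values is therefore unchanged by the factor c^(q-1), which is the product of the `scalePart`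
  -- values and must be 1.
  fermat : ∀ c → q ≢ 0 → c ^F q ≡ c
  fermat c q≢0 with c ≟ 0#
  ... | yes refl = zero-power q q≢0
    where
    zero-power : ∀ n → n ≢ 0 → 0# ^F n ≡ 0#
    zero-power zero    n≢0 = ⊥-elim (n≢0 refl)
    zero-power (suc n) _   = zeroˡ _
  ... | no c≢0 = trans (sym (product-const-except (λ i → scalePart c (Inverse.from card i)) c (Inverse.to card 0#)
                         at-zero elsewhere))
                   (trans (cong (c *_) product≡1) (*-identityʳ c))
    where
    scaling : Carrier ↔ Carrier
    scaling = mk↔ₛ′ (c *_) (proj₁ (inverse c c≢0) *_)
      (λ x → trans (sym (*-assoc _ _ _)) (trans (cong (_* x) (proj₂ (inverse c c≢0))) (*-identityˡ x)))
      (λ x → trans (sym (*-assoc _ _ _)) (trans (cong (_* x) (trans (*-comm _ c) (proj₂ (inverse c c≢0)))) (*-identityˡ x)))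

    at-zero : scalePart c (Inverse.from card (Inverse.to card 0#)) ≡ 1#
    at-zero with Inverse.from card (Inverse.to card 0#) ≟ 0#
    ... | yes _ = refl
    ... | no ne = ⊥-elim (ne (Inverse.strictlyInverseʳ card 0#))

    elsewhere : ∀ j → j ≢ Inverse.to card 0# → scalePart c (Inverse.from card j) ≡ c
    elsewhere j j≢ with Inverse.from card j ≟ 0#
    ... | yes eq = ⊥-elim (j≢ (trans (sym (Inverse.strictlyInverseˡ card j)) (cong (Inverse.to card) eq)))
    ... | no _ = refl

    product≡1 : Product.total (scalePart c) ≡ 1#
    product≡1 = *-cancelˡ (product-≢0 (unitPart ∘ Inverse.from card) (λ _ → unitPart≢0 _)) (begin
      U * Product.total (scalePart c)                        ≡⟨ *-comm U _ ⟩
      Product.total (scalePart c) * U                        ≡⟨ Product.∑-distrib-+ {q} _ _ ⟨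
      Product.total (λ x → scalePart c x * unitPart x)
        ≡⟨ Product.sum-cong-≗ {q} (λ i → unitPart-scale c≢0 (Inverse.from card i)) ⟨
      Product.total (λ x → unitPart (c * x))                 ≡⟨ Product.total-reindex scaling unitPart ⟨
      U                                                      ≡⟨ *-identityʳ U ⟨
      U * 1#                                                 ∎)
      where
      open ≡-Reasoning
      U = Product.total unitPart

-- The ring of polynomials as coefficient lists.

module PolynomialRing {q : ℕ} (F : FiniteField q) where
  open FiniteField F using (Carrier; 0#; 1#) renaming (_+_ to _+F_; _*_ to _*F_)
  open Poly F
  module K = FieldTheory F

  -- Unlike _≈_, the record lets unification recover the two polynomials.
  infix 4 _≋_
  record _≋_ (p r : Pol) : Set where
    constructor mk
    field at : p ≈ r
  open _≋_ public

  ≋-refl : ∀ {p} → p ≋ p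
  ≋-refl = mk (λ _ → refl)

  ≋-sym : ∀ {p r} → p ≋ r → r ≋ p
  ≋-sym e = mk (λ i → sym (at e i))

  ≋-trans : ∀ {p r s} → p ≋ r → r ≋ s → p ≋ s
  ≋-trans e e′ = mk (λ i → trans (at e i) (at e′ i))

  ≋-setoid : Setoid 0ℓ 0ℓ
  ≋-setoid = record { Carrier = Pol ; _≈_ = _≋_ ; isEquivalence = record { refl = ≋-refl ; sym = ≋-sym ; trans = ≋-trans } }

  open import Relation.Binary.Reasoning.Setoid ≋-setoid

  ∷-cong : ∀ {a b p r} → a ≡ b → p ≋ r → a ∷ p ≋ b ∷ r
  ∷-cong a≡b e = mk λ { zero → a≡b ; (suc i) → at e i }

  tail-cong : ∀ {a b p r} → a ∷ p ≋ b ∷ r → p ≋ r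
  tail-cong e = mk (at e ∘ suc)

  0∷[]≋[] : 0# ∷ [] ≋ []
  0∷[]≋[] = mk λ { zero → refl ; (suc i) → refl }

  coeff-+ : ∀ p r i → coeff (p + r) i ≡ coeff p i +F coeff r i
  coeff-+ []      r       i       = sym (K.+-identityˡ _)
  coeff-+ (a ∷ p) []      i       = sym (K.+-identityʳ _)
  coeff-+ (a ∷ p) (b ∷ r) zero    = refl
  coeff-+ (a ∷ p) (b ∷ r) (suc i) = coeff-+ p r i

  coeff-· : ∀ c p i → coeff (c · p) i ≡ c *F coeff p i
  coeff-· c []      i       = sym (K.zeroʳ c)
  coeff-· c (a ∷ p) zero    = refl
  coeff-· c (a ∷ p) (suc i) = coeff-· c p i

  +-cong : ∀ {p p′ r r′} → p ≋ p′ → r ≋ r′ → p + r ≋ p′ + r′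
  +-cong {p} {p′} {r} {r′} e e′ = mk λ i →
    trans (coeff-+ p r i) (trans (cong₂ _+F_ (at e i) (at e′ i)) (sym (coeff-+ p′ r′ i)))

  ·-cong : ∀ {c p p′} → p ≋ p′ → c · p ≋ c · p′
  ·-cong {c} {p} {p′} e = mk λ i →
    trans (coeff-· c p i) (trans (cong (c *F_) (at e i)) (sym (coeff-· c p′ i)))

  +-assoc : ∀ p r s → (p + r) + s ≋ p + (r + s)
  +-assoc p r s = mk λ i → trans (coeff-+ (p + r) s i) (trans (cong (_+F coeff s i) (coeff-+ p r i))
    (trans (K.+-assoc _ _ _) (trans (cong (coeff p i +F_) (sym (coeff-+ r s i))) (sym (coeff-+ p (r + s) i)))))

  +-comm : ∀ p r → p + r ≋ r + p
  +-comm p r = mk λ i → trans (coeff-+ p r i) (trans (K.+-comm _ _) (sym (coeff-+ r p i)))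

  +-identityʳ : ∀ p → p + [] ≋ p
  +-identityʳ p = mk λ i → trans (coeff-+ p [] i) (K.+-identityʳ _)

  neg-inverseʳ : ∀ p → p + neg p ≋ []
  neg-inverseʳ p = mk λ i → trans (coeff-+ p (neg p) i)
    (trans (cong (coeff p i +F_) (trans (coeff-· _ p i) (K.-1*x≈-x _))) (K.-‿inverseʳ _))

  +-interchange : ∀ p r s t → (p + r) + (s + t) ≋ (p + s) + (r + t)
  +-interchange p r s t = begin
    (p + r) + (s + t) ≈⟨ +-assoc p r _ ⟩
    p + (r + (s + t)) ≈⟨ +-cong (≋-refl {p}) (+-assoc r s t) ⟨
    p + ((r + s) + t) ≈⟨ +-cong (≋-refl {p}) (+-cong (+-comm r s) (≋-refl {t})) ⟩
    p + ((s + r) + t) ≈⟨ +-cong (≋-refl {p}) (+-assoc s r t) ⟩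
    p + (s + (r + t)) ≈⟨ +-assoc p s _ ⟨
    (p + s) + (r + t) ∎

  ·-distribˡ : ∀ c p r → c · (p + r) ≋ c · p + c · r
  ·-distribˡ c p r = mk λ i → trans (coeff-· c (p + r) i) (trans (cong (c *F_) (coeff-+ p r i))
    (trans (K.distribˡ _ _ _) (trans (cong₂ _+F_ (sym (coeff-· c p i)) (sym (coeff-· c r i)))
      (sym (coeff-+ (c · p) (c · r) i)))))

  ·-distribʳ : ∀ c d p → (c +F d) · p ≋ c · p + d · p
  ·-distribʳ c d p = mk λ i → trans (coeff-· _ p i) (trans (K.distribʳ _ _ _)
    (trans (cong₂ _+F_ (sym (coeff-· c p i)) (sym (coeff-· d p i))) (sym (coeff-+ (c · p) (d · p) i))))

  ·-assoc : ∀ c d p → (c *F d) · p ≋ c · (d · p)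
  ·-assoc c d p = mk λ i → trans (coeff-· _ p i) (trans (K.*-assoc _ _ _)
    (sym (trans (coeff-· c (d · p) i) (cong (c *F_) (coeff-· d p i)))))

  ·-identity : ∀ p → 1# · p ≋ p
  ·-identity p = mk λ i → trans (coeff-· _ p i) (K.*-identityˡ _)

  ·-zero : ∀ p → 0# · p ≋ []
  ·-zero p = mk λ i → trans (coeff-· _ p i) (K.zeroˡ _)

  0∷-+ : ∀ p r → 0# ∷ (p + r) ≋ (0# ∷ p) + (0# ∷ r)
  0∷-+ p r = ∷-cong (sym (K.+-identityˡ 0#)) ≋-refl

  *-congˡ : ∀ p {r r′} → r ≋ r′ → p * r ≋ p * r′
  *-congˡ []      e = ≋-refl
  *-congˡ (a ∷ p) e = +-cong (·-cong e) (∷-cong refl (*-congˡ p e))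

  *-zeroʳ : ∀ p → p * [] ≋ []
  *-zeroʳ []      = ≋-refl
  *-zeroʳ (a ∷ p) = ≋-trans (∷-cong refl (*-zeroʳ p)) 0∷[]≋[]

  -- The mirror image of the defining recursion of `_*_`, which is on the left factor; commutativity
  -- follows from it by induction.
  *-∷ : ∀ p b r → p * (b ∷ r) ≋ b · p + (0# ∷ (p * r))
  *-∷ []      b r = ≋-sym 0∷[]≋[]
  *-∷ (a ∷ p) b r = begin
    a · (b ∷ r) + (0# ∷ (p * (b ∷ r)))       ≈⟨ ∷-cong (cong (_+F 0#) (K.*-comm a b)) (begin
      a · r + p * (b ∷ r)                    ≈⟨ +-cong ≋-refl (*-∷ p b r) ⟩
      a · r + (b · p + (0# ∷ (p * r)))       ≈⟨ +-assoc (a · r) (b · p) _ ⟨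
      (a · r + b · p) + (0# ∷ (p * r))       ≈⟨ +-cong (+-comm (a · r) (b · p)) ≋-refl ⟩
      (b · p + a · r) + (0# ∷ (p * r))       ≈⟨ +-assoc (b · p) (a · r) _ ⟩
      b · p + (a · r + (0# ∷ (p * r)))       ∎) ⟩
    b · (a ∷ p) + (0# ∷ ((a ∷ p) * r))       ∎

  *-comm : ∀ p r → p * r ≋ r * p
  *-comm []      r = ≋-sym (*-zeroʳ r)
  *-comm (a ∷ p) r = ≋-trans (+-cong ≋-refl (∷-cong refl (*-comm p r))) (≋-sym (*-∷ r a p))

  *-cong : ∀ {p p′ r r′} → p ≋ p′ → r ≋ r′ → p * r ≋ p′ * r′
  *-cong {p} {p′} {r} {r′} e e′ = begin
    p * r    ≈⟨ *-congˡ p e′ ⟩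
    p * r′   ≈⟨ *-comm p r′ ⟩
    r′ * p   ≈⟨ *-congˡ r′ e ⟩
    r′ * p′  ≈⟨ *-comm r′ p′ ⟩
    p′ * r′  ∎

  *-distribˡ : ∀ p r s → p * (r + s) ≋ p * r + p * s
  *-distribˡ []      r s = ≋-refl
  *-distribˡ (a ∷ p) r s = begin
    a · (r + s) + (0# ∷ (p * (r + s)))
      ≈⟨ +-cong (·-distribˡ a r s) (∷-cong refl (*-distribˡ p r s)) ⟩
    (a · r + a · s) + (0# ∷ (p * r + p * s))                ≈⟨ +-cong ≋-refl (0∷-+ (p * r) (p * s)) ⟩
    (a · r + a · s) + ((0# ∷ (p * r)) + (0# ∷ (p * s)))     ≈⟨ +-interchange (a · r) (a · s) _ _ ⟩
    (a · r + (0# ∷ (p * r))) + (a · s + (0# ∷ (p * s)))     ∎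

  *-distribʳ : ∀ p r s → (r + s) * p ≋ r * p + s * p
  *-distribʳ p r s = ≋-trans (*-comm (r + s) p)
    (≋-trans (*-distribˡ p r s) (+-cong (*-comm p r) (*-comm p s)))

  ·-*-assoc : ∀ c p r → (c · p) * r ≋ c · (p * r)
  ·-*-assoc c []      r = ≋-refl
  ·-*-assoc c (a ∷ p) r = begin
    (c *F a) · r + (0# ∷ ((c · p) * r))       ≈⟨ +-cong (·-assoc c a r) (∷-cong (sym (K.zeroʳ c)) (·-*-assoc c p r)) ⟩
    c · (a · r) + c · (0# ∷ (p * r))          ≈⟨ ·-distribˡ c (a · r) _ ⟨
    c · (a · r + (0# ∷ (p * r)))              ∎

  0∷-* : ∀ p r → (0# ∷ p) * r ≋ 0# ∷ (p * r)
  0∷-* p r = +-cong (·-zero r) ≋-refl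

  *-assoc : ∀ p r s → (p * r) * s ≋ p * (r * s)
  *-assoc []      r s = ≋-refl
  *-assoc (a ∷ p) r s = begin
    (a · r + (0# ∷ (p * r))) * s          ≈⟨ *-distribʳ s (a · r) _ ⟩
    (a · r) * s + (0# ∷ (p * r)) * s      ≈⟨ +-cong (·-*-assoc a r s) (0∷-* (p * r) s) ⟩
    a · (r * s) + (0# ∷ ((p * r) * s))    ≈⟨ +-cong ≋-refl (∷-cong refl (*-assoc p r s)) ⟩
    a · (r * s) + (0# ∷ (p * (r * s)))    ∎

  const-* : ∀ c p → const c * p ≋ c · p
  const-* c p = ≋-trans (+-cong ≋-refl 0∷[]≋[]) (+-identityʳ (c · p))

  *-identityˡ : ∀ p → one * p ≋ p
  *-identityˡ p = ≋-trans (const-* 1# p) (·-identity p)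

  T-* : ∀ p → T * p ≋ 0# ∷ p
  T-* p = ≋-trans (0∷-* one p) (∷-cong refl (*-identityˡ p))

  ∷-split : ∀ a p → a ∷ p ≋ const a + T * p
  ∷-split a p = ≋-trans (∷-cong (sym (K.+-identityʳ a)) ≋-refl) (+-cong (≋-refl {const a}) (≋-sym (T-* p)))

  -- Opaque, so that the unfolded ring that appears in later types stays small.
  abstract
    isCommutativeRing : IsCommutativeRing _≋_ _+_ _*_ neg [] one
    isCommutativeRing = record
      { isRing = record
        { +-isAbelianGroup = record
          { isGroup = record
            { isMonoid = record
              { isSemigroup = record
                { isMagma = record { isEquivalence = Setoid.isEquivalence ≋-setoid ; ∙-cong = +-cong }
                ; assoc = +-assoc }
              ; identity = (λ _ → ≋-refl) , +-identityʳ }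
            ; inverse = (λ p → ≋-trans (+-comm (neg p) p) (neg-inverseʳ p)) , neg-inverseʳ
            ; ⁻¹-cong = ·-cong }
          ; comm = +-comm }
        ; *-cong = *-cong
        ; *-assoc = *-assoc
        ; *-identity = *-identityˡ , λ p → ≋-trans (*-comm p one) (*-identityˡ p)
        ; distrib = *-distribˡ , *-distribʳ }
      ; *-comm = *-comm }

  ring : CommutativeRing 0ℓ 0ℓ
  ring = record { isCommutativeRing = isCommutativeRing }

-- Degrees and monic polynomials.

module Degree {q : ℕ} (F : FiniteField q) where
  open FiniteField F using (Carrier; 0#; 1#; 0≢1; inverse) renaming (_+_ to _+F_; _*_ to _*F_)
  open Poly F
  open PolynomialRing F

  -- A strict bound on the degree: the zero polynomial is the case `n` = 0, and `Bounded r e` is the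
  -- remainder condition for division by a polynomial of degree `e`.
  record Bounded (p : Pol) (n : ℕ) : Set where
    constructor mkB
    field vanish : ∀ i → n ≤ i → coeff p i ≡ 0#
  open Bounded public

  record Deg (p : Pol) (d : ℕ) : Set where
    constructor mkD
    field
      lead  : coeff p d ≢ 0#
      bound : Bounded p (suc d)
  open Deg public

  Deg⇒HasDegree : ∀ {p d} → Deg p d → HasDegree p d
  Deg⇒HasDegree D = lead D , vanish (bound D)

  HasDegree⇒Deg : ∀ {p d} → HasDegree p d → Deg p d
  HasDegree⇒Deg (l , b) = mkD l (mkB b)

  Bounded-cong : ∀ {p r n} → p ≋ r → Bounded p n → Bounded r n
  Bounded-cong e b = mkB λ i n≤i → trans (sym (at e i)) (vanish b i n≤i)

  Deg-cong : ∀ {p r d} → p ≋ r → Deg p d → Deg r d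
  Deg-cong e D = mkD (λ z → lead D (trans (at e _) z)) (Bounded-cong e (bound D))

  Bounded-mono : ∀ {p m n} → m ≤ n → Bounded p m → Bounded p n
  Bounded-mono m≤n b = mkB λ i n≤i → vanish b i (ℕₚ.≤-trans m≤n n≤i)

  Bounded-[] : ∀ {n} → Bounded [] n
  Bounded-[] = mkB λ _ _ → refl

  Bounded-+ : ∀ p r {n} → Bounded p n → Bounded r n → Bounded (p + r) n
  Bounded-+ p r b b′ = mkB λ i n≤i → trans (coeff-+ p r i)
    (trans (cong₂ _+F_ (vanish b i n≤i) (vanish b′ i n≤i)) (K.+-identityˡ 0#))

  Bounded-· : ∀ c p {n} → Bounded p n → Bounded (c · p) n
  Bounded-· c p b = mkB λ i n≤i → trans (coeff-· c p i) (trans (cong (c *F_) (vanish b i n≤i)) (K.zeroʳ c))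

  Bounded-∷ : ∀ {a p n} → Bounded p n → Bounded (a ∷ p) (suc n)
  Bounded-∷ b = mkB λ { (suc i) (s≤s n≤i) → vanish b i n≤i }

  Bounded-tail : ∀ {a p n} → Bounded (a ∷ p) (suc n) → Bounded p n
  Bounded-tail b = mkB λ i n≤i → vanish b (suc i) (s≤s n≤i)

  Bounded-0 : ∀ {p} → Bounded p 0 → p ≋ []
  Bounded-0 b = mk λ i → vanish b i z≤n

  Deg-∷ : ∀ {a p d} → Deg p d → Deg (a ∷ p) (suc d)
  Deg-∷ D = mkD (lead D) (Bounded-∷ (bound D))

  Deg-tail : ∀ {a p d} → Deg (a ∷ p) (suc d) → Deg p d
  Deg-tail D = mkD (lead D) (Bounded-tail (bound D))

  Deg-∷-0 : ∀ {a p} → Deg (a ∷ p) 0 → p ≋ []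
  Deg-∷-0 D = Bounded-0 (Bounded-tail (bound D))

  Deg-≢0 : ∀ {p d} → Deg p d → ¬ p ≋ []
  Deg-≢0 D e = lead D (at e _)

  zero-or-degree : ∀ p → p ≋ [] ⊎ ∃ (Deg p)
  zero-or-degree [] = inj₁ ≋-refl
  zero-or-degree (a ∷ p) with zero-or-degree p
  ... | inj₂ (d , D) = inj₂ (suc d , Deg-∷ D)
  ... | inj₁ e with a K.≟ 0#
  ...   | yes refl = inj₁ (≋-trans (∷-cong refl e) 0∷[]≋[])
  ...   | no  a≢0  = inj₂ (0 , mkD a≢0 (mkB λ { (suc i) _ → at e i }))

  Deg<Bounded : ∀ {p d n} → Deg p d → Bounded p n → d < n
  Deg<Bounded {d = d} {n} D b with d ℕ.<? n
  ... | yes d<n = d<n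
  ... | no  d≮n = ⊥-elim (lead D (vanish b d (ℕₚ.≮⇒≥ d≮n)))

  Deg-unique : ∀ {p d e} → Deg p d → Deg p e → d ≡ e
  Deg-unique D E = ℕₚ.≤-antisym (ℕₚ.≤-pred (Deg<Bounded D (bound E))) (ℕₚ.≤-pred (Deg<Bounded E (bound D)))

  Deg-+ : ∀ {p r d} → Deg p d → Bounded r d → Deg (p + r) d × coeff (p + r) d ≡ coeff p d
  Deg-+ {p} {r} {d} D b = mkD (λ z → lead D (trans (sym top) z))
      (Bounded-+ p r (bound D) (Bounded-mono (ℕₚ.n≤1+n d) b)) , top
    where
    top : coeff (p + r) d ≡ coeff p d
    top = trans (coeff-+ p r d) (trans (cong (coeff p d +F_) (vanish b d ℕₚ.≤-refl)) (K.+-identityʳ _))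

  Deg-· : ∀ {c p d} → c ≢ 0# → Deg p d → Deg (c · p) d
  Deg-· {c} {p} {d} c≢0 D = mkD (λ z → K.*-≢0 c≢0 (lead D) (trans (sym (coeff-· c p d)) z)) (Bounded-· c p (bound D))

  coeff-top : ∀ p r d e → Bounded p (suc d) → Bounded r (suc e) →
    coeff (p * r) (d ℕ.+ e) ≡ coeff p d *F coeff r e × Bounded (p * r) (suc (d ℕ.+ e))
  coeff-top []      r d       e b b′ = sym (K.zeroˡ _) , Bounded-[]
  coeff-top (a ∷ p) r zero    e b b′ =
    trans (at a∷p≋ e) (coeff-· a r e) , Bounded-cong (≋-sym a∷p≋) (Bounded-· a r b′)
    where
    a∷p≋ : (a ∷ p) * r ≋ a · r
    a∷p≋ = ≋-trans (+-cong (≋-refl {a · r}) (≋-trans (∷-cong refl (*-cong {r = r} (Bounded-0 (Bounded-tail b)) ≋-refl)) 0∷[]≋[]))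
      (+-identityʳ (a · r))
  coeff-top (a ∷ p) r (suc d) e b b′ with coeff-top p r d e (Bounded-tail b) b′
  ... | top , bd =
    trans (coeff-+ (a · r) _ (suc d ℕ.+ e))
      (trans (cong₂ _+F_ (vanish (Bounded-· a r b′) _ (s≤s (ℕₚ.m≤n+m e d))) top) (K.+-identityˡ _)) ,
    Bounded-+ (a · r) _ (Bounded-· a r (Bounded-mono (s≤s (ℕₚ.m≤n+m e (suc d))) b′)) (Bounded-∷ bd)

  coeff-*-lead : ∀ {p r d e} → Deg p d → Deg r e → coeff (p * r) (d ℕ.+ e) ≡ coeff p d *F coeff r e
  coeff-*-lead {p} {r} D E = proj₁ (coeff-top p r _ _ (bound D) (bound E))

  Deg-* : ∀ {p r d e} → Deg p d → Deg r e → Deg (p * r) (d ℕ.+ e)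
  Deg-* {p} {r} D E = mkD (λ z → K.*-≢0 (lead D) (lead E) (trans (sym (coeff-*-lead D E)) z))
    (proj₂ (coeff-top p r _ _ (bound D) (bound E)))

  Deg-factors : ∀ {a d} b x → Deg a d → a ≋ b * x → ∃₂ λ e f → Deg b e × Deg x f × d ≡ e ℕ.+ f
  Deg-factors b x D eq with zero-or-degree b | zero-or-degree x
  ... | inj₁ z | _ = ⊥-elim (Deg-≢0 D (≋-trans eq (*-cong {r = x} z ≋-refl)))
  ... | inj₂ _ | inj₁ z = ⊥-elim (Deg-≢0 D (≋-trans eq (≋-trans (*-congˡ b z) (*-zeroʳ b))))
  ... | inj₂ (e , E) | inj₂ (f , E′) = e , f , E , E′ , Deg-unique D (Deg-cong (≋-sym eq) (Deg-* E E′))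

  Deg-const : ∀ {c} → c ≢ 0# → Deg (const c) 0
  Deg-const c≢0 = mkD c≢0 (mkB λ { (suc i) _ → refl })

  Deg-one : Deg one 0
  Deg-one = Deg-const (0≢1 ∘ sym)

  Deg-0⇒const : ∀ {p} → Deg p 0 → ∃ λ c → c ≢ 0# × p ≋ const c
  Deg-0⇒const {p} D = coeff p 0 , lead D , mk λ { zero → refl ; (suc i) → vanish (bound D) (suc i) (s≤s z≤n) }

  Deg-0⇒unit : ∀ {p} → Deg p 0 → ∃ λ v → v * p ≋ one
  Deg-0⇒unit {p} D with Deg-0⇒const D
  ... | c , c≢0 , p≋c with inverse c c≢0
  ... | c⁻¹ , cc⁻¹≡1 = const c⁻¹ , ≋-trans (*-congˡ (const c⁻¹) p≋c)
    (≋-trans (const-* c⁻¹ (const c)) (∷-cong (trans (K.*-comm c⁻¹ c) cc⁻¹≡1) ≋-refl))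

  record Mon (p : Pol) (d : ℕ) : Set where
    constructor mkM
    field
      deg     : Deg p d
      leading : coeff p d ≡ 1#
  open Mon public

  Monic⇒Mon : ∀ {p d} → Monic p d → Mon p d
  Monic⇒Mon (h , l) = mkM (HasDegree⇒Deg h) l

  Mon⇒Monic : ∀ {p d} → Mon p d → Monic p d
  Mon⇒Monic M = Deg⇒HasDegree (deg M) , leading M

  Mon-* : ∀ {p r d e} → Mon p d → Mon r e → Mon (p * r) (d ℕ.+ e)
  Mon-* M N = mkM (Deg-* (deg M) (deg N))
    (trans (coeff-*-lead (deg M) (deg N)) (trans (cong₂ _*F_ (leading M) (leading N)) (K.*-identityˡ 1#)))

  Mon-cofactor : ∀ {a d b e} x → Mon a d → Mon b e → a ≋ b * x → ∃ λ f → Mon x f × d ≡ e ℕ.+ f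
  Mon-cofactor {b = b} x A B eq with Deg-factors b x (deg A) eq
  ... | e , f , E , X , refl with Deg-unique E (deg B)
  ... | refl = f , mkM X (begin
      coeff x f               ≡⟨ K.*-identityˡ _ ⟨
      1# *F coeff x f         ≡⟨ cong (_*F _) (leading B) ⟨
      coeff b e *F coeff x f  ≡⟨ coeff-*-lead (deg B) X ⟨
      coeff (b * x) (e ℕ.+ f) ≡⟨ at eq _ ⟨
      _                       ≡⟨ leading A ⟩
      1#                      ∎) , refl
    where open ≡-Reasoning

  Mon-0 : ∀ {p} → Mon p 0 → p ≋ one
  Mon-0 M = mk λ { zero → leading M ; (suc i) → vanish (bound (deg M)) (suc i) (s≤s z≤n) }

  normalize : ∀ {p d} → Deg p d → ∃ λ c → Mon (c · p) d × ∃ λ c′ → p ≋ c′ · (c · p)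
  normalize {p} {d} D with inverse (coeff p d) (lead D)
  ... | c , eq = c , mkM (Deg-· c≢0 D) (trans (coeff-· c p d) (trans (K.*-comm c _) eq)) ,
      coeff p d , ≋-trans (≋-sym (·-identity p)) (≋-trans (mk λ i → cong (λ t → coeff (t · p) i) (sym eq)) (·-assoc (coeff p d) c p))
    where
    c≢0 : c ≢ 0#
    c≢0 refl = 0≢1 (trans (sym (K.zeroʳ _)) eq)

-- Euclidean division, Bezout relations and prime factors.

module Euclid {q : ℕ} (F : FiniteField q) (1+1≡0 : HasCharacteristic2 (FieldTheory.ring F)) where
  open FiniteField F using (Carrier; 0#; 1#; 0≢1; inverse) renaming (_+_ to _+F_; _*_ to _*F_)
  open Poly F hiding (_∣_) public
  open PolynomialRing F public
  open Degree F public
  open import Relation.Binary.Reasoning.Setoid ≋-setoid public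

  abstract
    poly-char2 : one + one ≋ []
    poly-char2 = ≋-trans (∷-cong 1+1≡0 ≋-refl) 0∷[]≋[]

  open Divisibility ring poly-char2 public
    using (module CommonMultiples; solve; _:=_; _:+_; _:*_; :-_; con; :0; :1; _∣_; _,_; quotient; equality; ∣-refl; ∣-trans; ∣-respʳ; ∣-respˡ; ∣-*; ∣-+; ∣-+-cancelʳ;
           Coprime; Coprime-sym; Bezout; ∏; *-congʳ; +-congˡ; +-congʳ; *-identityʳ)

  +-self : ∀ p → p + p ≋ []
  +-self = solve 1 (λ p → p :+ p := :0) ≋-refl

  +≋0⇒≋ : ∀ p r → p + r ≋ [] → p ≋ r
  +≋0⇒≋ p r e = begin
    p             ≈⟨ solve 2 (λ p r → p := (p :+ r) :+ r) ≋-refl p r ⟩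
    (p + r) + r   ≈⟨ +-cong e (≋-refl {r}) ⟩
    r             ∎

  *-cancelˡ : ∀ {a x y} → ¬ a ≋ [] → a * x ≋ a * y → x ≋ y
  *-cancelˡ {a} {x} {y} a≢0 e with zero-or-degree a | zero-or-degree (x + y)
  ... | inj₁ z       | _            = ⊥-elim (a≢0 z)
  ... | inj₂ _       | inj₁ z       = +≋0⇒≋ x y z
  ... | inj₂ (_ , A) | inj₂ (_ , D) = ⊥-elim (Deg-≢0 (Deg-* A D) (begin
    a * (x + y)    ≈⟨ *-distribˡ a x y ⟩
    a * x + a * y  ≈⟨ +-cong e (≋-refl {a * y}) ⟩
    a * y + a * y  ≈⟨ +-self (a * y) ⟩
    []             ∎))

  -- Horner's scheme: the remainder of the tail, shifted by T and completed by `a₀`, has degree at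
  -- most `e`. Adding the multiple `l` of `b` cancels its coefficient at `e`, since addition is
  -- subtraction here.
  division : ∀ a {b e} → Deg b e → ∃₂ λ s r → a ≋ b * s + r × Bounded r e
  division [] {b} B = [] , [] , ≋-sym (≋-trans (+-identityʳ (b * [])) (*-zeroʳ b)) , Bounded-[]
  division (a₀ ∷ a) {b} {e} B with division a B | inverse (coeff b e) (lead B)
  ... | s , r , a≋ , r< | c , bc≡1 = T * s + const l , r′ + l · b , split ,
      mkB λ i e≤i → trans (coeff-+ r′ (l · b) i) (drop i (ℕₚ.m≤n⇒m<n∨m≡n e≤i))
    where
    r′ = a₀ ∷ r
    l  = coeff r′ e *F c
    split : a₀ ∷ a ≋ b * (T * s + const l) + (r′ + l · b)
    split = begin
      a₀ ∷ a                                      ≈⟨ ∷-split a₀ a ⟩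
      const a₀ + T * a                            ≈⟨ +-congˡ {const a₀} (*-congˡ T a≋) ⟩
      const a₀ + T * (b * s + r)
        ≈⟨ solve 6 (λ a₀ t b s r l → a₀ :+ t :* (b :* s :+ r)
               := b :* (t :* s :+ l) :+ ((a₀ :+ t :* r) :+ l :* b)) ≋-refl (const a₀) T b s r (const l) ⟩
      b * (T * s + const l) + ((const a₀ + T * r) + const l * b)
        ≈⟨ +-congˡ {b * (T * s + const l)} (+-cong (∷-split a₀ r) (≋-sym (const-* l b))) ⟨
      b * (T * s + const l) + (r′ + l · b)        ∎
    drop : ∀ i → e < i ⊎ e ≡ i → coeff r′ i +F coeff (l · b) i ≡ 0#
    drop i (inj₁ e<i) = trans (cong₂ _+F_ (vanish (Bounded-∷ r<) i e<i) (vanish (Bounded-· l b (bound B)) i e<i)) (K.+-identityˡ 0#)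
    drop i (inj₂ refl) = trans (cong (coeff r′ e +F_) (trans (coeff-· l b e) lb≡)) (at (+-self (const (coeff r′ e))) 0)
      where
      lb≡ : coeff r′ e *F c *F coeff b e ≡ coeff r′ e
      lb≡ = trans (K.*-assoc _ _ _) (trans (cong (coeff r′ e *F_) (trans (K.*-comm c _) bc≡1)) (K.*-identityʳ _))

  -- Euclid's algorithm with `n` as the decreasing bound. Each step is an elementary matrix, which
  -- keeps the cofactor row unimodular; at b = 0 that row is (1, 0) whatever `a` is.
  bezout-below : ∀ n a b → Bounded b n → Bezout a b
  bezout-below n a b b< with zero-or-degree b
  ... | inj₁ b≋0 = record
    { d = a ; a′ = one ; b′ = [] ; σ = one ; ρ = []
    ; a≈da′ = ≋-sym (*-identityʳ a) ; b≈db′ = ≋-trans b≋0 (≋-sym (*-zeroʳ a))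
    ; unimodular = ≋-trans (+-identityʳ (one * one)) (*-identityˡ one) }
  bezout-below zero    a b b< | inj₂ (e , B) with () ← Deg<Bounded B b<
  bezout-below (suc n) a b b< | inj₂ (e , B) with division a B
  ... | s , r , a≋ , r< with bezout-below n b r (Bounded-mono (ℕₚ.≤-pred (Deg<Bounded B b<)) r<)
  ... | record { d = d ; a′ = b′ ; b′ = r′ ; σ = σ ; ρ = ρ ; a≈da′ = b≋ ; b≈db′ = r≋ ; unimodular = un } = record
    { d = d ; a′ = b′ * s + r′ ; b′ = b′ ; σ = ρ ; ρ = σ + ρ * s
    ; a≈da′ = begin
        a                      ≈⟨ a≋ ⟩
        b * s + r              ≈⟨ +-cong (*-congʳ {s} b≋) r≋ ⟩
        d * b′ * s + d * r′    ≈⟨ solve 4 (λ d b s r → d :* b :* s :+ d :* r := d :* (b :* s :+ r)) ≋-refl d b′ s r′ ⟩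
        d * (b′ * s + r′)      ∎
    ; b≈db′ = b≋
    ; unimodular = ≋-trans (solve 5 (λ σ ρ b s r → ρ :* (b :* s :+ r) :+ (σ :+ ρ :* s) :* b := σ :* b :+ ρ :* r) ≋-refl σ ρ b′ s r′) un }

  bezout : ∀ a b → Bezout a b
  bezout a b with zero-or-degree b
  ... | inj₁ e       = bezout-below 0 a b (Bounded-cong (≋-sym e) Bounded-[])
  ... | inj₂ (_ , B) = bezout-below _ a b (bound B)

  ∣-Deg : ∀ {a b d e} → a ∣ b → Deg a d → Deg b e → d ≤ e
  ∣-Deg {a} (x , eq) A B with Deg-factors a x B eq
  ... | _ , f , A′ , _ , refl with Deg-unique A A′
  ... | refl = ℕₚ.m≤m+n _ f

  _∣?_ : ∀ a b → Dec (a ∣ b)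
  a ∣? b with zero-or-degree a
  ... | inj₁ a≋0 with zero-or-degree b
  ...   | inj₁ b≋0     = yes ([] , ≋-trans b≋0 (≋-sym (*-zeroʳ a)))
  ...   | inj₂ (_ , B) = no λ (x , e) → Deg-≢0 B (≋-trans e (*-cong {r = x} a≋0 ≋-refl))
  a ∣? b | inj₂ (d , A) with division b A
  ... | s , r , b≋ , r< with zero-or-degree r
  ...   | inj₁ r≋0     = yes (s , ≋-trans b≋ (≋-trans (+-congˡ r≋0) (+-identityʳ (a * s))))
  ...   | inj₂ (_ , R) = no λ a∣b → ℕₚ.<⇒≱ (Deg<Bounded R r<)
    (∣-Deg (∣-+-cancelʳ (∣-respʳ (≋-trans b≋ (+-comm (a * s) r)) a∣b) (s , ≋-refl)) A R)

  -- Only finitely many polynomials lie below a degree bound, since the field is finite. This search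
  -- decides whether a proper divisor exists, and so makes prime divisors constructive. Invariance
  -- under `_≋_` reconciles lists of different length.
  any-below? : ∀ n {P : Pol → Set} → (∀ p → Dec (P p)) → (∀ {p r} → p ≋ r → P p → P r) →
    Dec (∃ λ p → Bounded p n × P p)
  any-below? zero P? P-cong = map′ (λ h → [] , Bounded-[] , h) (λ (p , b , h) → P-cong (Bounded-0 b) h) (P? [])
  any-below? (suc n) {P} P? P-cong = map′
    (λ (a , p , b , h) → a ∷ p , Bounded-∷ b , h)
    (λ { ([] , b , h) → 0# , [] , Bounded-[] , P-cong (≋-sym 0∷[]≋[]) h
       ; (a ∷ p , b , h) → a , p , Bounded-tail b , h })
    (K.any-field? (λ a → any-below? n (λ p → P? (a ∷ p)) (P-cong ∘ ∷-cong refl)))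

  NonConstant : Pol → Set
  NonConstant p = ∃ λ d → Deg p (suc d)

  nonConstant? : ∀ p → Dec (NonConstant p)
  nonConstant? p with zero-or-degree p
  ... | inj₁ p≋0           = no λ (_ , D) → Deg-≢0 D p≋0
  ... | inj₂ (suc d , D)   = yes (d , D)
  ... | inj₂ (zero  , D)   = no λ (_ , D′) → ℕₚ.0≢1+n (Deg-unique D D′)

  IsPrime : Pol → Set
  IsPrime p = ∀ a b → p ∣ a * b → p ∣ a ⊎ p ∣ b

  -- The gcd of `f` and `a` is a constant, and then Bezout gives f ∣ b; or an associate of `f`, and
  -- then f ∣ a; or a divisor of intermediate degree, which is excluded.
  irreducible⇒prime : ∀ {f d} → Deg f (suc d) →
    ¬ (∃ λ g → Bounded g (suc d) × NonConstant g × g ∣ f) → IsPrime f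
  irreducible⇒prime {f} {d} D irr a b (x , ab≋) = go (Deg-factors _ _ D B.a≈da′)
    where
    module B = Bezout (bezout f a)
    go : (∃₂ λ e e′ → Deg B.d e × Deg B.a′ e′ × suc d ≡ e ℕ.+ e′) → f ∣ a ⊎ f ∣ b
    go (zero , _ , E , _) with Deg-0⇒unit E
    ... | v , vd≋1 = inj₂ (v * (B.σ * b + B.ρ * x) , (begin
      b                                       ≈⟨ *-identityˡ b ⟨
      one * b                                 ≈⟨ *-congʳ {b} vd≋1 ⟨
      v * B.d * b                             ≈⟨ *-congʳ {b} (*-congˡ v B.combination) ⟩
      v * (B.σ * f + B.ρ * a) * b
        ≈⟨ solve 6 (λ v σ f ρ a b → v :* (σ :* f :+ ρ :* a) :* b
               := v :* (σ :* f :* b :+ ρ :* (a :* b))) ≋-refl v B.σ f B.ρ a b ⟩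
      v * (B.σ * f * b + B.ρ * (a * b))       ≈⟨ *-congˡ v (+-congˡ (*-congˡ B.ρ ab≋)) ⟩
      v * (B.σ * f * b + B.ρ * (f * x))
        ≈⟨ solve 6 (λ v σ f ρ b x → v :* (σ :* f :* b :+ ρ :* (f :* x))
               := f :* (v :* (σ :* b :+ ρ :* x))) ≋-refl v B.σ f B.ρ b x ⟩
      f * (v * (B.σ * b + B.ρ * x))           ∎))
    go (suc e , zero , E , E′ , _) with Deg-0⇒unit E′
    ... | v , va≋1 = inj₁ (v * B.b′ , (begin
      a                       ≈⟨ B.b≈db′ ⟩
      B.d * B.b′              ≈⟨ *-congʳ {B.b′} (≋-trans (*-congˡ B.d va≋1) (*-identityʳ B.d)) ⟨
      B.d * (v * B.a′) * B.b′
        ≈⟨ solve 4 (λ d v a b → d :* (v :* a) :* b := d :* a :* (v :* b)) ≋-refl B.d v B.a′ B.b′ ⟩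
      B.d * B.a′ * (v * B.b′) ≈⟨ *-congʳ {v * B.b′} B.a≈da′ ⟨
      f * (v * B.b′)          ∎))
    go (suc e , suc e′ , E , _ , eq) = ⊥-elim (irr (B.d ,
      Bounded-mono (s≤s (ℕₚ.≤-trans (ℕₚ.m≤m+n (suc e) e′) (ℕₚ.≤-reflexive (trans (sym (ℕₚ.+-suc e e′)) (sym (ℕₚ.suc-injective eq)))))) (bound E) ,
      (e , E) , B.a′ , B.a≈da′))

  record PrimeMonic (p : Pol) : Set where
    field
      {degree-1} : ℕ
      monic : Mon p (suc degree-1)
      prime : IsPrime p
    degree : ℕ
    degree = suc degree-1
  open PrimeMonic public

  ·-∣ : ∀ {p r} c c′ → p ≋ c′ · (c · p) → p ∣ r → (c · p) ∣ r
  ·-∣ {p} c c′ eq (x , e) = const c′ * x , (begin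
    _                               ≈⟨ e ⟩
    p * x                           ≈⟨ *-congʳ {x} (≋-trans eq (≋-sym (const-* c′ (c · p)))) ⟩
    const c′ * (c · p) * x          ≈⟨ solve 3 (λ k p x → k :* p :* x := p :* (k :* x)) ≋-refl (const c′) (c · p) x ⟩
    (c · p) * (const c′ * x)        ∎)

  prime-divisor-below : ∀ n f {d} → Deg f (suc d) → d < n → ∃ λ p → PrimeMonic p × p ∣ f
  prime-divisor-below (suc n) f {d} D d<n
    with any-below? (suc d) (λ g → nonConstant? g ×-dec (g ∣? f)) (λ e ((k , G) , g∣f) → (k , Deg-cong e G) , ∣-respˡ e g∣f)
  ... | yes (g , b , (k , G) , g∣f) with prime-divisor-below n g G
        (ℕₚ.≤-trans (ℕₚ.≤-pred (Deg<Bounded G b)) (ℕₚ.≤-pred d<n))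
  ...   | p , P , p∣g = p , P , ∣-trans p∣g g∣f
  prime-divisor-below (suc n) f {d} D d<n | no irr with normalize D
  ... | c , M , c′ , f≋ = c · f , record { monic = M ; prime = λ a b h →
          [ inj₁ ∘ ·-∣ c c′ f≋ , inj₂ ∘ ·-∣ c c′ f≋ ]′ (irreducible⇒prime D irr a b (∣-trans (∣-scaled) h)) } ,
        ·-∣ c c′ f≋ ∣-refl
    where
    ∣-scaled : f ∣ (c · f)
    ∣-scaled = const c , ≋-trans (≋-sym (const-* c f)) (*-comm (const c) f)

  prime-divisor : ∀ {f} → NonConstant f → ∃ λ p → PrimeMonic p × p ∣ f
  prime-divisor {f} (d , D) = prime-divisor-below (suc d) f D ℕₚ.≤-refl

  prime≢unit : ∀ {p x} → PrimeMonic p → p ∣ x → ¬ Deg x 0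
  prime≢unit P p∣x X with () ← ∣-Deg p∣x (deg (monic P)) X

  prime∣prime⇒≋ : ∀ {p r} → PrimeMonic p → PrimeMonic r → p ∣ r → p ≋ r
  prime∣prime⇒≋ {p} {r} P R (x , r≋px) with Mon-cofactor x (monic R) (monic P) r≋px
  ... | f , X , deg≡ with prime R p x (one , ≋-trans (≋-sym r≋px) (≋-sym (*-identityʳ r)))
  ... | inj₂ r∣x = ⊥-elim (ℕₚ.m+n≮n _ f (subst (_≤ f) deg≡ (∣-Deg r∣x (deg (monic R)) (deg X))))
  ... | inj₁ r∣p with ℕₚ.n≤0⇒n≡0 (ℕₚ.+-cancelˡ-≤ (degree P) f 0 (subst₂ _≤_ deg≡ (sym (ℕₚ.+-identityʳ _)) (∣-Deg r∣p (deg (monic R)) (deg (monic P)))))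
  ... | refl = ≋-sym (≋-trans r≋px (≋-trans (*-congˡ p (Mon-0 X)) (*-identityʳ p)))

  prime∤⇒coprime : ∀ {p s} → PrimeMonic p → ¬ (p ∣ s) → Coprime p s
  prime∤⇒coprime {p} {s} P p∤s with prime P B.d B.a′ (one , ≋-trans (≋-sym B.a≈da′) (≋-sym (*-identityʳ p)))
    where module B = Bezout (bezout p s)
  ... | inj₁ p∣d = ⊥-elim (p∤s (∣-respʳ (≋-sym (Bezout.b≈db′ (bezout p s))) (∣-* _ p∣d)))
  -- From p = d a′ and a′ = p x follows d x = 1, so the gcd is a unit and its Bezout relation can be
  -- scaled by `x`.
  ... | inj₂ (x , a′≋) = x * B.σ , x * B.ρ , (begin
      x * B.σ * p + x * B.ρ * s
        ≈⟨ solve 5 (λ x σ p ρ s → x :* σ :* p :+ x :* ρ :* s := (σ :* p :+ ρ :* s) :* x) ≋-refl x B.σ p B.ρ s ⟩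
      (B.σ * p + B.ρ * s) * x      ≈⟨ *-congʳ {x} B.combination ⟨
      B.d * x                      ≈⟨ *-cancelˡ (Deg-≢0 (deg (monic P))) (begin
        p * (B.d * x)              ≈⟨ solve 3 (λ p d x → p :* (d :* x) := d :* (p :* x)) ≋-refl p B.d x ⟩
        B.d * (p * x)              ≈⟨ *-congˡ B.d a′≋ ⟨
        B.d * B.a′                 ≈⟨ B.a≈da′ ⟨
        p                          ≈⟨ *-identityʳ p ⟨
        p * one                    ∎) ⟩
      one                          ∎)
    where module B = Bezout (bezout p s)

  -- `∏ primes` is the radical of `m`. Inclusion-exclusion involves only quotients of `m` by
  -- products of distinct primes, so repeated factors are collected in `cofactor`.
  record PrimeFactors (m : Pol) : Set where
    field
      cofactor : Pol
      {cofactor-degree} : ℕ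
      cofactor-monic : Mon cofactor cofactor-degree
      primes : List Pol
      primes-prime : All PrimeMonic primes
      primes-coprime : AllPairs Coprime primes
      product : m ≋ cofactor * ∏ primes
      complete : ∀ {p} → PrimeMonic p → p ∣ m → Any (p ∣_) primes

  primeFactors-below : ∀ n {m d} → Mon m d → d < n → PrimeFactors m
  primeFactors-below (suc n) {m} {zero} M _ = record
    { cofactor = m ; cofactor-monic = M ; primes = [] ; primes-prime = [] ; primes-coprime = []
    ; product = ≋-sym (*-identityʳ m) ; complete = λ P p∣m → ⊥-elim (prime≢unit P p∣m (deg M)) }
  primeFactors-below (suc n) {m} {suc d} M d<n with prime-divisor (d , deg M)
  ... | p , P , m′ , m≋ with Mon-cofactor m′ M (monic P) m≋
  ... | f , M′ , deg≡ with primeFactors-below n M′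
        (ℕₚ.≤-trans (ℕₚ.≤-trans (s≤s (ℕₚ.m≤n+m f _)) (ℕₚ.≤-reflexive (sym deg≡))) (ℕₚ.≤-pred d<n))
  ... | A with Any.any? (p ∣?_) (PrimeFactors.primes A)
  ... | yes p∣S = record
      { cofactor = A.cofactor * p ; cofactor-monic = Mon-* A.cofactor-monic (monic P)
      ; primes = A.primes ; primes-prime = A.primes-prime ; primes-coprime = A.primes-coprime
      ; product = ≋-trans m≋ (≋-trans (*-congˡ p A.product) (solve 3 (λ p k s → p :* (k :* s) := k :* p :* s) ≋-refl p A.cofactor (∏ A.primes)))
      ; complete = λ {r} R r∣m → [ (λ r∣p → Any.map (∣-trans r∣p) p∣S) , A.complete R ]′ (prime R p m′ (∣-respʳ m≋ r∣m)) }
    where module A = PrimeFactors A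
  ... | no p∤S = record
      { cofactor = A.cofactor ; cofactor-monic = A.cofactor-monic
      ; primes = p ∷ A.primes ; primes-prime = P ∷ A.primes-prime
      ; primes-coprime = All.map (prime∤⇒coprime P) (¬Any⇒All¬ _ p∤S) ∷ A.primes-coprime
      ; product = ≋-trans m≋ (≋-trans (*-congˡ p A.product) (solve 3 (λ p k s → p :* (k :* s) := k :* (p :* s)) ≋-refl p A.cofactor (∏ A.primes)))
      ; complete = λ {r} R r∣m → [ here , there ∘ A.complete R ]′ (prime R p m′ (∣-respʳ m≋ r∣m)) }
    where module A = PrimeFactors A

  primeFactors : ∀ {m d} → Mon m d → PrimeFactors m
  primeFactors M = primeFactors-below _ M ℕₚ.≤-refl

-- Numerical estimates for the degree of the primitive part.

module Numerics where
  open import Data.Nat using (_+_; _*_; _∸_; _^_; NonZero; >-nonZero; pred)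
  open import Data.Nat.Properties
  open +-*-Solver using (solve; _:=_; _:+_; _:*_; con)

  -- The degree of the primitive part, by inclusion-exclusion from the degrees δ of the C_n(u), n of degree κ.
  -- Since prime degrees are positive, a list entry d stands for a prime of degree suc d.
  primitiveDegree : (ℕ → ℕ) → ℕ → List ℕ → ℕ
  primitiveDegree δ κ []       = δ κ
  primitiveDegree δ κ (d ∷ ds) = primitiveDegree δ (κ + suc d) ds ∸ primitiveDegree δ κ ds

  totalDegree : List ℕ → ℕ
  totalDegree []       = 0
  totalDegree (d ∷ ds) = suc d + totalDegree ds

  3+3*d≡3*suc : ∀ d → 3 + (d + (d + d)) ≡ 3 * suc d
  3+3*d≡3*suc = solve 1 (λ d → con 3 :+ (d :+ (d :+ d)) := con 3 :* (con 1 :+ d)) refl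

  module Bounds (q : ℕ) (4≤q : 4 ≤ q) where

    Q : ℕ → ℕ
    Q d = pred (q ^ suc d)

    -- Euler's function of a product of distinct primes with the listed degrees.
    φ : List ℕ → ℕ
    φ []       = 1
    φ (d ∷ ds) = Q d * φ ds

    private
      r : ℕ
      r = q ∸ 4
      q≡ : q ≡ 4 + r
      q≡ = sym (m+[n∸m]≡n 4≤q)
      instance
        q≢0 : NonZero q
        q≢0 = >-nonZero (≤-trans (s≤s z≤n) 4≤q)

      -- Source of the long constants below: with q = 4 + r, the difference of the two sides of each
      -- estimate is a polynomial with nonnegative coefficients, and `k` is that difference.
      slack : ∀ {m n} k → m + k ≡ n → m ≤ n
      slack {m} k eq = ≤-trans (m≤m+n m k) (≤-reflexive eq)

    suc-Q : ∀ d → suc (Q d) ≡ q ^ suc d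
    suc-Q d = suc-pred (q ^ suc d) ⦃ m^n≢0 q (suc d) ⦄

    power-lower : ∀ d → q * suc d ≤ q ^ suc d
    power-lower zero    = ≤-refl
    power-lower (suc d) = *-monoʳ-≤ q (≤-trans (≤-trans
      (slack (2 + 3 * d) (solve 1 (λ d → con 2 :+ d :+ (con 2 :+ con 3 :* d) := con 4 :* (con 1 :+ d)) refl d))
      (*-monoˡ-≤ (suc d) 4≤q)) (power-lower d))

    -- The left side is q (d + 1) - 1, expanded for q = 4 + r.
    Q-lower : ∀ d → 3 + 4 * d + r + r * d ≤ Q d
    Q-lower d = ≤-pred (≤-trans (≤-reflexive eq) (≤-trans (power-lower d) (≤-reflexive (sym (suc-Q d)))))
      where
      eq : suc (3 + 4 * d + r + r * d) ≡ q * suc d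
      eq = trans (solve 2 (λ d r → con 4 :+ con 4 :* d :+ r :+ r :* d := (con 4 :+ r) :* (con 1 :+ d)) refl d r)
        (cong (_* suc d) (sym q≡))

    totalDegree<φ : ∀ ds → totalDegree ds < φ ds
    totalDegree<φ []       = s≤s z≤n
    totalDegree<φ (d ∷ ds) = ≤-trans
      (slack (1 + 2 * d + 2 * s + 3 * d * s) (solve 2 (λ d s → con 2 :+ d :+ s :+ (con 1 :+ con 2 :* d :+ con 2 :* s :+ con 3 :* d :* s) := (con 3 :+ con 3 :* d) :* (con 1 :+ s)) refl d s))
      (*-mono-≤ (≤-trans (slack {3 + 3 * d} (d + r + r * d) (solve 2 (λ d r → con 3 :+ con 3 :* d :+ (d :+ r :+ r :* d) := con 3 :+ con 4 :* d :+ r :+ r :* d) refl d r)) (Q-lower d)) (totalDegree<φ ds))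
      where s = totalDegree ds

    -- For u = 1 and square-free m the primitive part has degree at least (φ - 1) / q. Of the
    -- summand 2, one unit pays for this -1 and the other makes the comparison strict.
    Large : List ℕ → Set
    Large ds = q * totalDegree ds + 2 ≤ φ ds

    Large-∷ : ∀ d ds → Large ds → Large (d ∷ ds)
    Large-∷ d ds h = ≤-trans (≤-trans (≤-reflexive (cong (λ t → t * (suc d + s) + 2) q≡))
      (slack (4 * d + r + r * d + (4 + r) * s * (2 + 4 * d + r + r * d))
        (solve 3 (λ d r s → (con 4 :+ r) :* (con 1 :+ d :+ s) :+ con 2 :+ (con 4 :* d :+ r :+ r :* d :+ (con 4 :+ r) :* s :* (con 2 :+ con 4 :* d :+ r :+ r :* d))
          := (con 3 :+ con 4 :* d :+ r :+ r :* d) :* ((con 4 :+ r) :* s :+ con 2)) refl d r s)))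
      (*-mono-≤ (Q-lower d) (≤-trans (≤-reflexive (cong (λ t → t * s + 2) (sym q≡))) h))
      where s = totalDegree ds

    Q-large : ∀ d → q * (2 + d) + 2 ≤ Q (suc d)
    Q-large d = ≤-pred (≤-trans (≤-trans (≤-reflexive (cong (λ t → suc (t * (2 + d) + 2)) q≡))
      (≤-trans (slack (5 + 6 * r + r * r + 12 * d + 7 * r * d + r * r * d)
        (solve 2 (λ d r → con 1 :+ ((con 4 :+ r) :* (con 2 :+ d) :+ con 2) :+ (con 5 :+ con 6 :* r :+ r :* r :+ con 12 :* d :+ con 7 :* r :* d :+ r :* r :* d)
           := (con 4 :+ r) :* ((con 4 :+ r) :* (con 1 :+ d))) refl d r))
        (≤-trans (≤-reflexive (cong (λ t → t * (t * suc d)) (sym q≡))) (*-monoʳ-≤ q (power-lower d)))))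
      (≤-reflexive (sym (suc-Q (suc d)))))

    Q0-lower : 3 + r ≤ Q 0
    Q0-lower = ≤-trans (≤-reflexive (solve 1 (λ r → con 3 :+ r := con 3 :+ con 0 :+ r :+ r :* con 0) refl r)) (Q-lower 0)

    -- `Large` passes to longer lists, so it is checked only where it first appears: one prime of
    -- degree at least 2, such a prime next to a linear one, or a third prime added to two linear
    -- ones. For two linear primes it reads 2q + 2 ≤ (q - 1)², which at q = 4 is 10 ≤ 9.
    classify : ∀ ds → ds ≡ [] ⊎ ds ≡ 0 ∷ [] ⊎ ds ≡ 0 ∷ 0 ∷ [] ⊎ Large ds
    classify [] = inj₁ refl
    classify (d ∷ ds) with classify ds
    classify (zero  ∷ _) | inj₁ refl = inj₂ (inj₁ refl)
    classify (suc d ∷ _) | inj₁ refl = inj₂ (inj₂ (inj₂ (≤-trans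
      (≤-reflexive (cong (λ t → q * t + 2) (+-identityʳ (2 + d)))) (≤-trans (Q-large d) (≤-reflexive (sym (*-identityʳ _)))))))
    classify (zero  ∷ _) | inj₂ (inj₁ refl) = inj₂ (inj₂ (inj₁ refl))
    classify (suc d ∷ _) | inj₂ (inj₁ refl) = inj₂ (inj₂ (inj₂ (≤-trans (≤-trans
      (slack (q * (3 + 2 * d) + 4 + r * (q * (2 + d) + 2)) (solve 3 (λ q d r → q :* (con 2 :+ d :+ con 1) :+ con 2 :+ (q :* (con 3 :+ con 2 :* d) :+ con 4 :+ r :* (q :* (con 2 :+ d) :+ con 2)) := (q :* (con 2 :+ d) :+ con 2) :* ((con 3 :+ r) :* con 1)) refl q d r))
      (*-mono-≤ (Q-large d) (*-monoˡ-≤ 1 Q0-lower))) ≤-refl)))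
    classify (d ∷ _) | inj₂ (inj₂ (inj₁ refl)) = inj₂ (inj₂ (inj₂ (≤-trans (≤-reflexive (cong (λ t → t * (suc d + 2) + 2) q≡)) (≤-trans
      (slack _ (solve 2 (λ d r → (con 4 :+ r) :* (con 1 :+ d :+ con 2) :+ con 2 :+
          (con 13 :+ con 24 :* r :+ con 9 :* r :* r :+ r :* r :* r :+ con 32 :* d :+ con 32 :* r :* d :+ con 10 :* r :* r :* d :+ r :* r :* r :* d)
         := (con 3 :+ con 4 :* d :+ r :+ r :* d) :* ((con 3 :+ r) :* ((con 3 :+ r) :* con 1))) refl d r))
      (*-mono-≤ (Q-lower d) (*-mono-≤ Q0-lower (*-monoˡ-≤ 1 Q0-lower)))))))
    classify (d ∷ ds) | inj₂ (inj₂ (inj₂ h)) = inj₂ (inj₂ (inj₂ (Large-∷ d ds h)))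

    Large-11 : 5 ≤ q → Large (0 ∷ 0 ∷ [])
    Large-11 5≤q = ≤-trans
      (slack (4 + 6 * r′ + r′ * r′) (trans (cong (λ t → t * 2 + 2 + (4 + 6 * r′ + r′ * r′)) (sym (m+[n∸m]≡n 5≤q)))
        (solve 1 (λ r → (con 5 :+ r) :* con 2 :+ con 2 :+ (con 4 :+ con 6 :* r :+ r :* r) := (con 4 :+ r) :* ((con 4 :+ r) :* con 1)) refl r′)))
      (*-mono-≤ low (*-monoˡ-≤ 1 low))
      where
      r′ = q ∸ 5
      low : 4 + r′ ≤ Q 0
      low = ≤-trans (pred-mono-≤ (≤-reflexive (m+[n∸m]≡n 5≤q))) (≤-reflexive (cong pred (sym (*-identityʳ q))))

    φ-∷ : ∀ d ds → q ^ suc d * φ ds ≡ φ ds + φ (d ∷ ds)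
    φ-∷ d ds = cong (_* φ ds) (sym (suc-Q d))

    -- Where the degrees grow by exactly q per step, each subtraction contributes a factor q^(deg p)
    -- - 1, so the alternating sum factors. The offset `κ₀` allows for a δ that is geometric only
    -- from `κ₀` on.
    geometric : ∀ δ κ₀ A → (∀ κ → δ (κ₀ + κ) ≡ q ^ κ * A) →
      ∀ κ ds → primitiveDegree δ (κ₀ + κ) ds ≡ q ^ κ * A * φ ds
    geometric δ κ₀ A δ≡ κ []       = trans (δ≡ κ) (sym (*-identityʳ _))
    geometric δ κ₀ A δ≡ κ (d ∷ ds) = begin
      primitiveDegree δ (κ₀ + κ + suc d) ds ∸ primitiveDegree δ (κ₀ + κ) ds
        ≡⟨ cong₂ _∸_ (trans (cong (λ t → primitiveDegree δ t ds) (+-assoc κ₀ κ (suc d))) (geometric δ κ₀ A δ≡ (κ + suc d) ds))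
                     (geometric δ κ₀ A δ≡ κ ds) ⟩
      q ^ (κ + suc d) * A * φ ds ∸ x * φ ds
        ≡⟨ cong (λ t → t * A * φ ds ∸ x * φ ds) (^-distribˡ-+-* q κ (suc d)) ⟩
      q ^ κ * q ^ suc d * A * φ ds ∸ x * φ ds
        ≡⟨ cong (_∸ x * φ ds) (solve 4 (λ k p a f → k :* p :* a :* f
               := k :* a :* (p :* f)) refl (q ^ κ) (q ^ suc d) A (φ ds)) ⟩
      x * (q ^ suc d * φ ds) ∸ x * φ ds          ≡⟨ cong (λ t → x * t ∸ x * φ ds) (φ-∷ d ds) ⟩
      x * (φ ds + φ (d ∷ ds)) ∸ x * φ ds         ≡⟨ cong (_∸ x * φ ds) (*-distribˡ-+ x (φ ds) _) ⟩
      x * φ ds + x * φ (d ∷ ds) ∸ x * φ ds       ≡⟨ m+n∸m≡n (x * φ ds) _ ⟩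
      x * φ (d ∷ ds)                             ∎
      where
      open ≡-Reasoning
      x = q ^ κ * A

    primitiveDegree-positive : ∀ δ κ₀ A → 0 < A → (∀ κ → δ (κ₀ + κ) ≡ q ^ κ * A) →
      ∀ κ ds → totalDegree ds < primitiveDegree δ (κ₀ + κ) ds
    primitiveDegree-positive δ κ₀ A 0<A δ≡ κ ds = ≤-trans (totalDegree<φ ds)
      (≤-trans (≤-reflexive (sym (*-identityˡ (φ ds))))
        (≤-trans (*-monoˡ-≤ (φ ds) (*-mono-≤ (m^n>0 q κ) 0<A)) (≤-reflexive (sym (geometric δ κ₀ A δ≡ κ ds)))))

    module _ (δ : ℕ → ℕ) (δ0≡0 : δ 0 ≡ 0) (δ≡ : ∀ κ → δ (1 + κ) ≡ q ^ κ * 1) where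

      -- For u = 1 the degree is (φ(m) - μ(m)) / q.
      φ-approximation : ∀ ds → φ ds ≤ q * primitiveDegree δ 0 ds + 1 × q * primitiveDegree δ 0 ds ≤ φ ds + 1
      φ-approximation [] rewrite δ0≡0 = m≤n+m 1 _ , ≤-trans (≤-reflexive (*-zeroʳ q)) z≤n
      φ-approximation (d ∷ ds) with φ-approximation ds
      -- The error changes sign with every prime, so each of the two bounds rests on the other one
      -- for the shorter list.
      ... | lo , hi = lower , upper
        where
        G = primitiveDegree δ 0 ds
        eq : q * primitiveDegree δ 0 (d ∷ ds) ≡ φ ds + φ (d ∷ ds) ∸ q * G
        eq = begin
          q * (primitiveDegree δ (suc d) ds ∸ G)     ≡⟨ *-distribˡ-∸ q (primitiveDegree δ (suc d) ds) G ⟩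
          q * primitiveDegree δ (suc d) ds ∸ q * G   ≡⟨ cong (λ t → q * t ∸ q * G) (geometric δ 1 1 δ≡ d ds) ⟩
          q * (q ^ d * 1 * φ ds) ∸ q * G
            ≡⟨ cong (_∸ q * G) (solve 3 (λ q p f → q :* (p :* con 1 :* f) := q :* p :* f) refl q (q ^ d) (φ ds)) ⟩
          q ^ suc d * φ ds ∸ q * G                   ≡⟨ cong (_∸ q * G) (φ-∷ d ds) ⟩
          φ ds + φ (d ∷ ds) ∸ q * G                  ∎
          where open ≡-Reasoning
        upper : q * primitiveDegree δ 0 (d ∷ ds) ≤ φ (d ∷ ds) + 1
        upper = ≤-trans (≤-reflexive eq) (m≤n+o⇒m∸n≤o _ (q * G) (≤-trans (+-monoˡ-≤ (φ (d ∷ ds)) lo)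
          (≤-reflexive (solve 2 (λ x f → x :+ con 1 :+ f := x :+ (f :+ con 1)) refl (q * G) (φ (d ∷ ds))))))
        lower : φ (d ∷ ds) ≤ q * primitiveDegree δ 0 (d ∷ ds) + 1
        lower = +-cancelˡ-≤ (q * G) _ _ (≤-trans (+-monoˡ-≤ (φ (d ∷ ds)) hi)
          (≤-trans (≤-reflexive (solve 2 (λ a b → a :+ con 1 :+ b := a :+ b :+ con 1) refl (φ ds) (φ (d ∷ ds))))
            (≤-trans (+-monoˡ-≤ 1 (m≤n+m∸n (φ ds + φ (d ∷ ds)) (q * G)))
              (≤-reflexive (trans (cong (λ t → q * G + t + 1) (sym eq)) (+-assoc (q * G) _ 1))))))

      Large⇒totalDegree< : ∀ ds → Large ds → totalDegree ds < primitiveDegree δ 0 ds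
      Large⇒totalDegree< ds h = *-cancelˡ-< q _ _ (+-cancelʳ-≤ 1 _ _ (≤-trans
        (≤-reflexive (solve 1 (λ x → con 1 :+ x :+ con 1 := x :+ con 2) refl (q * totalDegree ds)))
        (≤-trans h (proj₁ (φ-approximation ds)))))

open Numerics

-- The Carlitz module: additivity, composition, expansion and degrees.

module Carlitz {q : ℕ} (F : FiniteField q)
  (1+1≡0 : HasCharacteristic2 (FieldTheory.ring F)) (e : ℕ) (q≡2^e : q ≡ 2 ℕ.^ e) (2<q : 2 < q) where
  open FiniteField F using (Carrier; 0#; 1#; 0≢1) renaming (_+_ to _+F_; _*_ to _*F_)
  open Euclid F 1+1≡0 public

  ^-cong : ∀ n {x y} → x ≋ y → x ^ n ≋ y ^ n
  ^-cong zero    _   = ≋-refl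
  ^-cong (suc n) x≋y = *-cong x≋y (^-cong n x≋y)

  ^-+ : ∀ x m n → x ^ (m ℕ.+ n) ≋ x ^ m * x ^ n
  ^-+ x zero    n = ≋-sym (*-identityˡ (x ^ n))
  ^-+ x (suc m) n = ≋-trans (*-congˡ x (^-+ x m n)) (≋-sym (*-assoc x (x ^ m) (x ^ n)))

  ^-2^suc : ∀ x k → x ^ (2 ℕ.^ suc k) ≋ x ^ (2 ℕ.^ k) * x ^ (2 ℕ.^ k)
  ^-2^suc x k = ≋-trans (≋-reflexive (cong (λ n → x ^ (2 ℕ.^ k ℕ.+ n)) (ℕₚ.+-identityʳ _))) (^-+ x (2 ℕ.^ k) (2 ℕ.^ k))
    where
    ≋-reflexive : ∀ {p r} → p ≡ r → p ≋ r
    ≋-reflexive refl = ≋-refl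

  frobenius-+ : ∀ k x y → (x + y) ^ (2 ℕ.^ k) ≋ x ^ (2 ℕ.^ k) + y ^ (2 ℕ.^ k)
  frobenius-+ zero    x y = solve 2 (λ x y → (x :+ y) :* :1 := x :* :1 :+ y :* :1) ≋-refl x y
  frobenius-+ (suc k) x y = begin
    (x + y) ^ (2 ℕ.^ suc k)          ≈⟨ ^-2^suc (x + y) k ⟩
    (x + y) ^ N * (x + y) ^ N        ≈⟨ *-cong (frobenius-+ k x y) (frobenius-+ k x y) ⟩
    (x ^ N + y ^ N) * (x ^ N + y ^ N)
      ≈⟨ solve 2 (λ x y → (x :+ y) :* (x :+ y) := x :* x :+ y :* y) ≋-refl (x ^ N) (y ^ N) ⟩
    x ^ N * x ^ N + y ^ N * y ^ N    ≈⟨ +-cong (^-2^suc x k) (^-2^suc y k) ⟨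
    x ^ (2 ℕ.^ suc k) + y ^ (2 ℕ.^ suc k) ∎
    where N = 2 ℕ.^ k

  ^-· : ∀ c x n → (c · x) ^ n ≋ (c K.^F n) · (x ^ n)
  ^-· c x zero    = ≋-sym (·-identity one)
  ^-· c x (suc n) = begin
    (c · x) * (c · x) ^ n
      ≈⟨ *-cong (≋-sym (const-* c x)) (≋-trans (^-· c x n) (≋-sym (const-* _ (x ^ n)))) ⟩
    (const c * x) * (const (c K.^F n) * x ^ n)
      ≈⟨ solve 4 (λ c x d y → (c :* x) :* (d :* y)
             := c :* (d :* (x :* y))) ≋-refl (const c) x (const (c K.^F n)) (x ^ n) ⟩
    const c * (const (c K.^F n) * (x * x ^ n)) ≈⟨ ≋-trans (const-* c _) (·-cong (const-* (c K.^F n) (x * x ^ n))) ⟩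
    c · ((c K.^F n) · (x * x ^ n))       ≈⟨ ·-assoc c (c K.^F n) (x * x ^ n) ⟨
    (c *F c K.^F n) · (x * x ^ n)        ∎

  CT-cong : ∀ {x y} → x ≋ y → CT x ≋ CT y
  CT-cong x≋y = +-cong (*-congˡ T x≋y) (^-cong q x≋y)

  CT-+ : ∀ x y → CT (x + y) ≋ CT x + CT y
  CT-+ x y = ≋-trans
    (+-cong (*-distribˡ T x y) (subst (λ n → (x + y) ^ n ≋ x ^ n + y ^ n) (sym q≡2^e) (frobenius-+ e x y)))
    (+-interchange (T * x) (T * y) (x ^ q) (y ^ q))

  CT-· : ∀ c x → CT (c · x) ≋ c · CT x
  CT-· c x = begin
    T * (c · x) + (c · x) ^ q            ≈⟨ +-cong (begin
      T * (c · x)          ≈⟨ *-congˡ T (const-* c x) ⟨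
      T * (const c * x)    ≈⟨ solve 3 (λ t c x → t :* (c :* x) := c :* (t :* x)) ≋-refl T (const c) x ⟩
      const c * (T * x)    ≈⟨ const-* c (T * x) ⟩
      c · (T * x)          ∎) (subst (λ d → (c · x) ^ q ≋ d · (x ^ q)) (K.fermat c λ { refl → ℕₚ.n≮0 2<q }) (^-· c x q)) ⟩
    c · (T * x) + c · (x ^ q)            ≈⟨ ·-distribˡ c (T * x) (x ^ q) ⟨
    c · (T * x + x ^ q)                  ∎

  CT-[] : CT [] ≋ []
  CT-[] = ≋-trans (CT-cong (≋-sym (·-zero []))) (≋-trans (CT-· 0# []) (·-zero _))

  C-shift : ∀ i m x → carlitzFrom (suc i) m x ≡ carlitzFrom i m (CT x)
  C-shift i []      x = refl
  C-shift i (a ∷ m) x = cong₂ (λ t r → a · t + r) (iter i) (C-shift (suc i) m x)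
    where
    iter : ∀ j → CTiter (suc j) x ≡ CTiter j (CT x)
    iter zero    = refl
    iter (suc j) = cong CT (iter j)

  -- Mutual induction: `C-∷` is `C-shift` followed by this commutation for the tail, and the
  -- commutation for `a ∷ m` is `C-∷` together with the linearity of `CT`.
  C-CT : ∀ m x → C m (CT x) ≋ CT (C m x)
  C-∷ : ∀ a m x → C (a ∷ m) x ≋ a · x + CT (C m x)

  C-CT []      x = ≋-sym CT-[]
  C-CT (a ∷ m) x = begin
    C (a ∷ m) (CT x)            ≈⟨ C-∷ a m (CT x) ⟩
    a · CT x + CT (C m (CT x))  ≈⟨ +-cong (CT-· a x) (CT-cong (≋-sym (C-CT m x))) ⟨
    CT (a · x) + CT (CT (C m x)) ≈⟨ CT-+ (a · x) (CT (C m x)) ⟨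
    CT (a · x + CT (C m x))     ≈⟨ CT-cong (C-∷ a m x) ⟨
    CT (C (a ∷ m) x)            ∎
  C-∷ a m x = +-cong (≋-refl {a · x}) (subst (_≋ CT (C m x)) (sym (C-shift 0 m x)) (C-CT m x))

  C-congʳ : ∀ m {x y} → x ≋ y → C m x ≋ C m y
  C-congʳ []      _   = ≋-refl
  C-congʳ (a ∷ m) {x} {y} x≋y = ≋-trans (C-∷ a m x) (≋-trans (+-cong (·-cong x≋y) (CT-cong (C-congʳ m x≋y))) (≋-sym (C-∷ a m y)))

  C-zeroˡ : ∀ {m} x → m ≋ [] → C m x ≋ []
  C-zeroˡ {[]}    x _ = ≋-refl
  C-zeroˡ {a ∷ m} x z = begin
    C (a ∷ m) x         ≈⟨ C-∷ a m x ⟩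
    a · x + CT (C m x)
      ≈⟨ +-cong (subst (λ t → t · x ≋ []) (sym (at z 0)) (·-zero x)) (≋-trans (CT-cong (C-zeroˡ {m} x (mk (at z ∘ suc)))) CT-[]) ⟩
    []                  ∎

  C-congˡ : ∀ {m n} x → m ≋ n → C m x ≋ C n x
  C-congˡ {[]}    {n}     x m≋n = ≋-sym (C-zeroˡ x (≋-sym m≋n))
  C-congˡ {a ∷ m} {[]}    x m≋n = C-zeroˡ x m≋n
  C-congˡ {a ∷ m} {b ∷ n} x m≋n = begin
    C (a ∷ m) x         ≈⟨ C-∷ a m x ⟩
    a · x + CT (C m x)
      ≈⟨ +-cong (subst (λ t → a · x ≋ t · x) (at m≋n 0) ≋-refl) (CT-cong (C-congˡ x (tail-cong m≋n))) ⟩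
    b · x + CT (C n x)  ≈⟨ C-∷ b n x ⟨
    C (b ∷ n) x         ∎

  C-+ˡ : ∀ m n x → C (m + n) x ≋ C m x + C n x
  C-+ˡ []      n       x = ≋-refl
  C-+ˡ (a ∷ m) []      x = ≋-sym (+-identityʳ (C (a ∷ m) x))
  C-+ˡ (a ∷ m) (b ∷ n) x = begin
    C (a +F b ∷ m + n) x                        ≈⟨ C-∷ (a +F b) (m + n) x ⟩
    (a +F b) · x + CT (C (m + n) x)
      ≈⟨ +-cong (·-distribʳ a b x) (≋-trans (CT-cong (C-+ˡ m n x)) (CT-+ (C m x) (C n x))) ⟩
    (a · x + b · x) + (CT (C m x) + CT (C n x)) ≈⟨ +-interchange (a · x) (b · x) (CT (C m x)) (CT (C n x)) ⟩
    (a · x + CT (C m x)) + (b · x + CT (C n x)) ≈⟨ +-cong (C-∷ a m x) (C-∷ b n x) ⟨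
    C (a ∷ m) x + C (b ∷ n) x                   ∎

  C-·ˡ : ∀ c m x → C (c · m) x ≋ c · C m x
  C-·ˡ c []      x = ≋-refl
  C-·ˡ c (a ∷ m) x = begin
    C (c · (a ∷ m)) x                  ≈⟨ C-∷ (c *F a) (c · m) x ⟩
    (c *F a) · x + CT (C (c · m) x)    ≈⟨ +-cong (·-assoc c a x) (≋-trans (CT-cong (C-·ˡ c m x)) (CT-· c (C m x))) ⟩
    c · (a · x) + c · CT (C m x)       ≈⟨ ·-distribˡ c (a · x) (CT (C m x)) ⟨
    c · (a · x + CT (C m x))           ≈⟨ ·-cong (C-∷ a m x) ⟨
    c · C (a ∷ m) x                    ∎

  C-* : ∀ m n x → C (m * n) x ≋ C m (C n x)
  C-* []      n x = ≋-refl
  C-* (a ∷ m) n x = begin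
    C (a · n + (0# ∷ m * n)) x               ≈⟨ C-+ˡ (a · n) (0# ∷ m * n) x ⟩
    C (a · n) x + C (0# ∷ m * n) x
      ≈⟨ +-cong (C-·ˡ a n x) (≋-trans (C-∷ 0# (m * n) x) (+-cong (·-zero x) (CT-cong (C-* m n x)))) ⟩
    a · C n x + CT (C m (C n x))             ≈⟨ C-∷ a m (C n x) ⟨
    C (a ∷ m) (C n x)                        ∎

  ^q-cube : ∃ λ r → ∀ x → x ^ q ≡ x * (x * (x * x ^ r))
  ^q-cube = q ℕ.∸ 3 , λ x → cong (x ^_) (sym (ℕₚ.m+[n∸m]≡n 2<q))

  -- In `CT y` with `y` a multiple of `x`, the term `T * y` supplies the linear part, and `y ^ q` is
  -- divisible by y³, hence by x³, because q > 2.
  C-expand : ∀ m x → ∃ λ h → C m x ≋ x * (m + x * x * h)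
  C-expand []      x = [] , solve 1 (λ x → :0 := x :* (:0 :+ x :* x :* :0)) ≋-refl x
  C-expand (a ∷ m) x with C-expand m x | ^q-cube
  ... | h , eq | r , cube = T * h + w * w * w * y ^ r , (begin
    C (a ∷ m) x                                 ≈⟨ C-∷ a m x ⟩
    a · x + CT (C m x)                          ≈⟨ +-cong (≋-sym (const-* a x)) (CT-cong eq) ⟩
    const a * x + (T * y + y ^ q)
      ≈⟨ +-congˡ {const a * x} (+-congˡ {T * y} (subst (y ^ q ≋_) (cube y) ≋-refl)) ⟩
    const a * x + (T * y + y * (y * (y * y ^ r)))
      ≈⟨ solve 6 (λ a x t m h z → a :* x :+ (t :* (x :* (m :+ x :* x :* h)) :+ x :* (m :+ x :* x :* h) :* (x :* (m :+ x :* x :* h) :* (x :* (m :+ x :* x :* h) :* z)))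
           := x :* (a :+ t :* m :+ x :* x :* (t :* h :+ (m :+ x :* x :* h) :* (m :+ x :* x :* h) :* (m :+ x :* x :* h) :* z)))
         ≋-refl (const a) x T m h (y ^ r) ⟩
    x * (const a + T * m + x * x * (T * h + w * w * w * y ^ r)) ≈⟨ *-congˡ x (+-congʳ (∷-split a m)) ⟨
    x * ((a ∷ m) + x * x * (T * h + w * w * w * y ^ r)) ∎)
    where
    w y : Pol
    w = m + x * x * h
    y = x * w

  C-∣ : ∀ m x → x ∣ C m x
  C-∣ m x with C-expand m x
  ... | h , eq = m + x * x * h , eq

  Deg-^ : ∀ n {x d} → Deg x d → Deg (x ^ n) (n ℕ.* d)
  Deg-^ zero    D = Deg-one
  Deg-^ (suc n) D = Deg-* D (Deg-^ n D)

  Deg-T : Deg T 1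
  Deg-T = mkD (0≢1 ∘ sym) (mkB λ { (suc (suc i)) _ → refl ; (suc zero) (s≤s ()) })

  Deg-CT : ∀ {x d} → Deg x (suc d) → Deg (CT x) (q ℕ.* suc d)
  Deg-CT {x} {d} D = Deg-cong (+-comm (x ^ q) (T * x)) (proj₁ (Deg-+ (Deg-^ q D) (Bounded-mono ineq (bound (Deg-* Deg-T D)))))
    where
    ineq : suc (1 ℕ.+ suc d) ≤ q ℕ.* suc d
    ineq = ℕₚ.≤-trans (ℕₚ.≤-trans (s≤s (s≤s (s≤s (ℕₚ.m≤m+n d _)))) (ℕₚ.≤-reflexive (3+3*d≡3*suc d)))
      (ℕₚ.*-monoˡ-≤ (suc d) 2<q)

  -- The degrees of the CTiter i u increase strictly, so the top coefficient of m decides the degree of C m u.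
  Deg-C : ∀ {u} (δ : ℕ → ℕ) → (∀ i → Deg (CTiter i u) (δ i)) → (∀ i → δ i < δ (suc i)) →
    ∀ {m d} → Deg m d → Deg (C m u) (δ d)
  Deg-C {u} δ iter mono {m} = from 0 m
    where
    mono-+ : ∀ i j → δ i < δ (i ℕ.+ suc j)
    mono-+ i zero    = subst (λ k → δ i < δ k) (ℕₚ.+-comm 1 i) (mono i)
    mono-+ i (suc j) = ℕₚ.<-trans (mono-+ i j) (subst (λ k → δ (i ℕ.+ suc j) < δ k) (sym (ℕₚ.+-suc i (suc j))) (mono _))

    from : ∀ i m {d} → Deg m d → Deg (carlitzFrom i m u) (δ (i ℕ.+ d))
    from i []      D = ⊥-elim (lead D refl)
    from i (a ∷ m) {zero} D = Deg-cong
      (≋-sym (≋-trans (+-cong (≋-refl {a · CTiter i u}) (vanishing (suc i) m (Deg-∷-0 D))) (+-identityʳ _)))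
      (subst (λ k → Deg (a · CTiter i u) (δ k)) (sym (ℕₚ.+-identityʳ i)) (Deg-· (lead D) (iter i)))
      where
      vanishing : ∀ i m → m ≋ [] → carlitzFrom i m u ≋ []
      vanishing i []      z = ≋-refl
      vanishing i (a ∷ m) z = +-cong (subst (λ t → t · CTiter i u ≋ []) (sym (at z 0)) (·-zero (CTiter i u))) (vanishing (suc i) m (mk (at z ∘ suc)))
    from i (a ∷ m) {suc d} D = Deg-cong (+-comm (carlitzFrom (suc i) m u) (a · CTiter i u))
      (proj₁ (Deg-+ (subst (λ k → Deg (carlitzFrom (suc i) m u) (δ k)) (sym (ℕₚ.+-suc i d)) (from (suc i) m (Deg-tail D)))
        (Bounded-· a (CTiter i u) (Bounded-mono (mono-+ i d) (bound (iter i))))))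

-- The primitive part of C_m(u) and its prime divisors.

module Primitive {q : ℕ} (F : FiniteField q)
  (1+1≡0 : HasCharacteristic2 (FieldTheory.ring F)) (e : ℕ) (q≡2^e : q ≡ 2 ℕ.^ e) (2<q : 2 < q) where
  open FiniteField F using (0#; 1#)
  open Carlitz F 1+1≡0 e q≡2^e 2<q public

  ∣-fromDefs : ∀ {a b} → Poly._∣_ F a b → a ∣ b
  ∣-fromDefs (x , eq) = x , mk eq

  ∣-toDefs : ∀ {a b} → a ∣ b → Poly._∣_ F a b
  ∣-toDefs (x , eq) = x , at eq

  PrimeMonic⇒MonicPrime : ∀ {p} → PrimeMonic p → MonicPrime p
  PrimeMonic⇒MonicPrime P = (degree P , Mon⇒Monic (monic P) , s≤s z≤n) ,
    λ a b p∣ab → [ inj₁ ∘ ∣-toDefs , inj₂ ∘ ∣-toDefs ]′ (prime P a b (∣-fromDefs p∣ab))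

  degrees : ∀ {S} → All PrimeMonic S → List ℕ
  degrees []       = []
  degrees (P ∷ Ps) = degree-1 P ∷ degrees Ps

  Deg-∏ : ∀ {S} (Ps : All PrimeMonic S) → Deg (∏ S) (totalDegree (degrees Ps))
  Deg-∏ []       = Deg-one
  Deg-∏ (P ∷ Ps) = Deg-* (deg (monic P)) (Deg-∏ Ps)

  CT-Deg : ∀ {x d} → 0 < d → Deg x d → Deg (CT x) (q ℕ.* d)
  CT-Deg {d = suc d} _ = Deg-CT

  module Sequence (u : Pol) (δ : ℕ → ℕ) (iter : ∀ i → Deg (CTiter i u) (δ i)) (mono : ∀ i → δ i < δ (suc i)) where

    c : Pol → Pol
    c n = C n u

    c-Deg : ∀ {n d} → Deg n d → Deg (c n) (δ d)
    c-Deg = Deg-C δ iter mono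

    c-cong : ∀ {m n} → m ≋ n → c m ≋ c n
    c-cong = C-congˡ u

    c-*ʳ : ∀ n k → c (n * k) ≋ C k (c n)
    c-*ʳ n k = ≋-trans (c-cong (*-comm n k)) (C-* k n u)

    c-∣ : ∀ n k → c n ∣ c (n * k)
    c-∣ n k = ∣-respʳ (≋-sym (c-*ʳ n k)) (C-∣ k (c n))

    c-combination : ∀ a b {m n} → ∃₂ λ α β → c (a * m + b * n) ≋ α * c m + β * c n
    c-combination a b {m} {n} = quotient (C-∣ a (c m)) , quotient (C-∣ b (c n)) ,
      ≋-trans (C-+ˡ (a * m) (b * n) u) (+-cong (part a m) (part b n))
      where
      part : ∀ a m → c (a * m) ≋ quotient (C-∣ a (c m)) * c m
      part a m = ≋-trans (C-* a m u) (≋-trans (equality (C-∣ a (c m))) (*-comm (c m) _))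

    c-coprime : ∀ n {a b} → Coprime a b → ∃₂ λ α β → c n ≋ α * c (n * a) + β * c (n * b)
    c-coprime n {a} {b} (α , β , eq) with c-combination α β {n * a} {n * b}
    ... | α′ , β′ , eq′ = α′ , β′ , ≋-trans (c-cong n≋) eq′
      where
      n≋ : n ≋ α * (n * a) + β * (n * b)
      n≋ = begin
        n                              ≈⟨ *-identityʳ n ⟨
        n * one                        ≈⟨ *-congˡ n eq ⟨
        n * (α * a + β * b)
          ≈⟨ solve 5 (λ n α a β b → n :* (α :* a :+ β :* b) := α :* (n :* a) :+ β :* (n :* b)) ≋-refl n α a β b ⟩
        α * (n * a) + β * (n * b)      ∎

    open CommonMultiples bezout c c-cong c-∣ c-coprime

    cofactor-Deg : ∀ {a b d e} x → Deg b d → Deg a e → b ≋ a * x → Deg x (d ℕ.∸ e)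
    cofactor-Deg {a} x B A eq with Deg-factors a x B eq
    ... | e , f , A′ , X , refl with Deg-unique A′ A
    ... | refl = subst (Deg x) (sym (ℕₚ.m+n∸m≡n e f)) X

    -- By `LCM-∷` the degree of `R′` follows the recursion of `primitiveDegree`. The truncated
    -- subtraction there is exact, because the subtracted degree is that of a factor.
    lcm : ∀ {S} (Ps : All PrimeMonic S) → AllPairs Coprime S → ∀ {k κ} → Deg k κ →
      Σ (LCM k S) λ A → Deg (LCM.R′ A) (primitiveDegree δ κ (degrees Ps))
    lcm []       []        {k} K = LCM-[] *-cancelˡ k , Deg-cong (c-cong (≋-sym (*-identityʳ k))) (c-Deg K)
    lcm {s ∷ S} (P ∷ Ps) (s⊥S ∷ cop) {k} {κ} K = proj₁ A′ , cofactor-Deg (LCM.R′ (proj₁ A′)) (proj₂ B) (proj₂ A) (proj₂ A′)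
      where
      A : Σ (LCM k S) λ A → Deg (LCM.R′ A) (primitiveDegree δ κ (degrees Ps))
      A = lcm Ps cop K
      B : Σ (LCM (k * s) S) λ A → Deg (LCM.R′ A) (primitiveDegree δ (κ ℕ.+ degree P) (degrees Ps))
      B = lcm Ps cop (Deg-* K (deg (monic P)))
      A′ : Σ (LCM k (s ∷ S)) λ A′ → LCM.R′ (proj₁ B) ≋ LCM.R′ (proj₁ A) * LCM.R′ A′
      A′ = LCM-∷ *-cancelˡ (Deg-≢0 (c-Deg (Deg-* K (Deg-∏ Ps)))) s⊥S (proj₁ A) (proj₁ B)

    module Existence {m dm} (M : Mon m dm) (fac : PrimeFactors m) where
      open PrimeFactors fac

      A : LCM cofactor primes
      A = proj₁ (lcm primes-prime primes-coprime (deg cofactor-monic))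

      R : Pol
      R = LCM.R′ A

      R-Deg : Deg R (primitiveDegree δ cofactor-degree (degrees primes-prime))
      R-Deg = proj₂ (lcm primes-prime primes-coprime (deg cofactor-monic))

      dm≡ : dm ≡ cofactor-degree ℕ.+ totalDegree (degrees primes-prime)
      dm≡ = Deg-unique (deg M) (Deg-cong (≋-sym product) (Deg-* (deg cofactor-monic) (Deg-∏ primes-prime)))

      c-m≋ : c m ≋ LCM.L A * R
      c-m≋ = ≋-trans (c-cong product) (LCM.factorization A)

      R∣c-m : R ∣ c m
      R∣c-m = LCM.L A , ≋-trans c-m≋ (*-comm _ R)

      m≢0 : ¬ m ≋ []
      m≢0 = Deg-≢0 (deg M)

      -- The last expression is C_p(x) / x at x = c(m/p). It is a multiple of `R`, as x divides the
      -- common multiple L while C_p(x) = c(m) = L R.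
      Split : Pol → Set
      Split p = ∃ λ n → n * p ≋ m × ∃ λ h → R ∣ p + c n * c n * h

      splits : All Split primes
      splits = All.map split (CM-factors primes (LCM.common A))
        where
        split : ∀ {p} → (∃ λ n → n * p ≋ cofactor * ∏ primes × c n ∣ LCM.L A) → Split p
        split {p} (n , np≋ , (z , L≋)) with C-expand p (c n)
        ... | h , eq = n , np≋m , h , z , *-cancelˡ x≢0 (begin
            c n * (p + c n * c n * h)  ≈⟨ eq ⟨
            C p (c n)                  ≈⟨ c-*ʳ n p ⟨
            c (n * p)                  ≈⟨ c-cong np≋m ⟩
            c m                        ≈⟨ c-m≋ ⟩
            LCM.L A * R                ≈⟨ *-congʳ {R} L≋ ⟩
            c n * z * R                ≈⟨ solve 3 (λ x z r → x :* z :* r := x :* (r :* z)) ≋-refl (c n) z R ⟩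
            c n * (R * z)              ∎)
          where
          np≋m : n * p ≋ m
          np≋m = ≋-trans np≋ (≋-sym product)
          x≢0 : ¬ c n ≋ []
          x≢0 with Deg-factors n p (deg M) (≋-sym np≋m)
          ... | _ , _ , N , _ = Deg-≢0 (c-Deg N)

      cofactor-unique : ∀ {n n′ p} → n * p ≋ m → n′ * p ≋ m → n ≋ n′
      cofactor-unique {n} {n′} {p} e e′ = *-cancelˡ p≢0 (≋-trans (*-comm p n) (≋-trans e (≋-trans (≋-sym e′) (*-comm n′ p))))
        where
        p≢0 : ¬ p ≋ []
        p≢0 z = m≢0 (≋-trans (≋-sym e) (≋-trans (*-congˡ n z) (*-zeroʳ n)))

      -- For primes, ℘ ∣ p means ℘ = p, and `n` ranges over the single value m / p: this excludes
      -- the only way in which a prime divisor of `R` can fail to be new.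
      NotIntrinsic : Pol → Pol → Set
      NotIntrinsic ℘ p = ℘ ∣ p → ∀ n → n * p ≋ m → ¬ ℘ ∣ c n

      -- A prime killing a smaller n kills c (m / p) for some p; as R divides C_p(x) / x ≡ p mod x, where
      -- x = c (m / p), such a prime can divide R only if it is p itself.
      zsigmondy : ∀ {℘} → PrimeMonic ℘ → ℘ ∣ R → All (NotIntrinsic ℘) primes → Zsigmondy u m dm ℘
      zsigmondy {℘} P ℘∣R good = PrimeMonic⇒MonicPrime P , ∣-toDefs (∣-trans ℘∣R R∣c-m) ,
        λ n d N d<dm ℘∣cn → absurd {n} N d<dm (∣-fromDefs ℘∣cn)
        where
        absurd : ∀ {n d} → HasDegree n d → d < dm → ℘ ∣ c n → ⊥
        -- Let g = `B.d` be the gcd of n and m; ℘ divides c(g), a combination of c(n) and c(m).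
        -- Since deg n < deg m, the cofactor of g in m has a prime divisor p, so g divides m/p and ℘
        -- divides c(m/p).
        absurd {n} {d} N d<dm ℘∣cn = go (Deg-factors B.d B.b′ (deg M) B.b≈db′)
          where
          module B = Bezout (bezout n m)

          ℘∣cg : ℘ ∣ c B.d
          ℘∣cg with c-combination B.σ B.ρ {n} {m}
          ... | α , β , eq = ∣-respʳ (≋-sym (≋-trans (c-cong B.combination) eq))
            (∣-+ (∣-respʳ (*-comm (c n) α) (∣-* α ℘∣cn)) (∣-respʳ (*-comm (c m) β) (∣-* β (∣-trans ℘∣R R∣c-m))))

          contra : ∀ {p r} → PrimeMonic p → p ∣ B.b′ → PrimeMonic r × p ∣ r × Split r × NotIntrinsic ℘ r → ⊥
          contra {p} {r} Pp (x , b′≋px) (Pr , p∣r , (n₁ , n₁r≋m , h , R∣) , good-r) =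
            good-r ℘∣r n₁ n₁r≋m ℘∣cn₁
            where
            gx≋n₁ : B.d * x ≋ n₁
            gx≋n₁ = cofactor-unique (begin
              B.d * x * r      ≈⟨ solve 3 (λ g x r → g :* x :* r := g :* (r :* x)) ≋-refl B.d x r ⟩
              B.d * (r * x)    ≈⟨ *-congˡ B.d (*-congʳ {x} (prime∣prime⇒≋ Pp Pr p∣r)) ⟨
              B.d * (p * x)    ≈⟨ *-congˡ B.d b′≋px ⟨
              B.d * B.b′       ≈⟨ B.b≈db′ ⟨
              m                ∎) n₁r≋m
            ℘∣cn₁ : ℘ ∣ c n₁
            ℘∣cn₁ = ∣-respʳ (c-cong gx≋n₁) (∣-trans ℘∣cg (c-∣ B.d x))
            ℘∣r : ℘ ∣ r
            ℘∣r = ∣-+-cancelʳ (∣-trans ℘∣R R∣) (∣-* h (∣-* (c n₁) ℘∣cn₁))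

          go : (∃₂ λ a b → Deg B.d a × Deg B.b′ b × dm ≡ a ℕ.+ b) → ⊥
          go (a , zero , G , _ , eq) = ℕₚ.<⇒≱ d<dm (ℕₚ.≤-trans (ℕₚ.≤-reflexive (trans eq (ℕₚ.+-identityʳ a)))
            (∣-Deg (B.a′ , B.a≈da′) G (HasDegree⇒Deg N)))
          go (a , suc b , _ , H , _) with prime-divisor (b , H)
          ... | p , Pp , p∣h = contra Pp p∣h (proj₁ (proj₁ found) , proj₂ found , proj₂ (proj₁ found))
            where
            found = All.lookupAny (All.zip (primes-prime , All.zip (splits , good)))
              (complete Pp (∣-trans p∣h (B.d , ≋-trans B.b≈db′ (*-comm B.d B.b′))))

      Goal : Set
      Goal = Σ Pol (Zsigmondy u m dm)

      -- Each prime p of m divides R at most once, unless p is itself a Zsigmondy prime.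
      peel : ∀ {S′ R′ ρ} (Ps : All PrimeMonic S′) → All Split S′ → R′ ∣ R → Deg R′ ρ → totalDegree (degrees Ps) < ρ →
        (∀ {℘} → PrimeMonic ℘ → ℘ ∣ R′ → Goal ⊎ Any (℘ ∣_) S′) → Goal
      -- All primes of m have been removed and the degree is still positive, so a prime divisor is
      -- left, and `hyp` has only its first alternative.
      peel {ρ = suc ρ} [] [] R′∣R D _ hyp with prime-divisor (ρ , D)
      ... | ℘ , P , ℘∣R′ with hyp P ℘∣R′
      ...   | inj₁ z = z
      peel {p ∷ S′} {R′} {ρ} (P ∷ Ps) ((n , np≋m , h , R∣) ∷ sp) R′∣R D t<ρ hyp with p ∣? R′
      ... | no p∤R′ = peel Ps sp R′∣R D (ℕₚ.≤-<-trans (ℕₚ.m≤n+m _ (degree P)) t<ρ) (λ Q ℘∣R′ → skip Q ℘∣R′ (hyp Q ℘∣R′))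
        where
        skip : ∀ {℘} → PrimeMonic ℘ → ℘ ∣ R′ → Goal ⊎ Any (℘ ∣_) (p ∷ S′) → Goal ⊎ Any (℘ ∣_) S′
        skip Q ℘∣R′ (inj₁ z)          = inj₁ z
        skip Q ℘∣R′ (inj₂ (here ℘∣p)) = ⊥-elim (p∤R′ (∣-respˡ (prime∣prime⇒≋ Q P ℘∣p) ℘∣R′))
        skip Q ℘∣R′ (inj₂ (there i))  = inj₂ i
      ... | yes (R″ , R′≋) with p ∣? c n
      ...   | no p∤cn = p , zsigmondy P (∣-trans (R″ , R′≋) R′∣R) (All.map
                (λ Q p∣r n′ e p∣cn′ → p∤cn (∣-respʳ (c-cong {n′} {n} (cofactor-unique
                  (≋-trans (*-congˡ n′ (prime∣prime⇒≋ P Q p∣r)) e) np≋m)) p∣cn′)) primes-prime)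
      ...   | yes p∣cn with Deg-factors p R″ D R′≋
      ...     | _ , ρ″ , D₁ , D″ , refl with Deg-unique D₁ (deg (monic P))
      ...       | refl = peel Ps sp (∣-trans R″∣R′ R′∣R) D″ (ℕₚ.+-cancelˡ-< (degree P) _ _ t<ρ)
                    (λ Q ℘∣R″ → skip Q ℘∣R″ (hyp Q (∣-trans ℘∣R″ R″∣R′)))
        where
        R″∣R′ : R″ ∣ R′
        R″∣R′ = p , ≋-trans R′≋ (*-comm p R″)

        square-∣ : p * p ∣ c n * c n * h
        square-∣ = x * x * h , ≋-trans (*-congʳ {h} (*-cong (equality p∣cn) (equality p∣cn)))
          (solve 3 (λ p x h → p :* x :* (p :* x) :* h := p :* p :* (x :* x :* h)) ≋-refl p x h)
          where x = quotient p∣cn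

        -- Otherwise p² divides both p + x² h and x² h, where x = c(m/p), and hence divides p.
        p∤R″ : ¬ p ∣ R″
        p∤R″ (y , R″≋) = ℕₚ.m+1+n≰m (degree P) (∣-Deg p²∣p (Deg-* (deg (monic P)) (deg (monic P))) (deg (monic P)))
          where
          p²∣p : p * p ∣ p
          p²∣p = ∣-+-cancelʳ (∣-trans (∣-trans (y , ≋-trans R′≋ (≋-trans (*-congˡ p R″≋) (≋-sym (*-assoc p p y)))) R′∣R) R∣) square-∣

        skip : ∀ {℘} → PrimeMonic ℘ → ℘ ∣ R″ → Goal ⊎ Any (℘ ∣_) (p ∷ S′) → Goal ⊎ Any (℘ ∣_) S′
        skip Q ℘∣R″ (inj₁ z)          = inj₁ z
        skip Q ℘∣R″ (inj₂ (here ℘∣p)) = ⊥-elim (p∤R″ (∣-respˡ (prime∣prime⇒≋ Q P ℘∣p) ℘∣R″))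
        skip Q ℘∣R″ (inj₂ (there i))  = inj₂ i

      exists : totalDegree (degrees primes-prime) < primitiveDegree δ cofactor-degree (degrees primes-prime) → Goal
      exists t<ρ = peel primes-prime splits ∣-refl R-Deg t<ρ λ {℘} P ℘∣R → decide P ℘∣R (Any.any? (℘ ∣?_) primes)
        where
        decide : ∀ {℘} → PrimeMonic ℘ → ℘ ∣ R → Dec (Any (℘ ∣_) primes) → Goal ⊎ Any (℘ ∣_) primes
        decide P ℘∣R (yes i) = inj₂ i
        decide {℘} P ℘∣R (no ¬i) = inj₁ (℘ , zsigmondy P ℘∣R (All.map (λ ℘∤p ℘∣p → ⊥-elim (℘∤p ℘∣p)) (¬Any⇒All¬ _ ¬i)))

open import Data.Nat using (_^_)

-- The exceptional case, u of positive degree, and u = 1.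

module Cases {q : ℕ} (F : FiniteField q)
  (1+1≡0 : HasCharacteristic2 (FieldTheory.ring F)) (e : ℕ) (q≡2^e : q ≡ 2 ^ e) (2<q : 2 < q) where
  open import Data.Nat using (_+_; _*_; _∸_)
  open FiniteField F using (Carrier; 0#; 1#)
  open Primitive F 1+1≡0 e q≡2^e 2<q renaming (_+_ to _⊕_; _*_ to _⊛_; _^_ to _^P_)

  4≤q : 4 ≤ q
  4≤q = subst (4 ≤_) (sym q≡2^e) (go e (subst (2 <_) q≡2^e 2<q))
    where
    go : ∀ e → 2 < 2 ^ e → 4 ≤ 2 ^ e
    go zero          (s≤s ())
    go (suc zero)    (s≤s (s≤s ()))
    go (suc (suc e)) _ = subst (4 ≤_) (ℕₚ.*-assoc 2 2 (2 ^ e)) (ℕₚ.*-monoʳ-≤ 4 (ℕₚ.m^n>0 2 e))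

  open Bounds q 4≤q

  one^ : ∀ n → one ^P n ≋ one
  one^ zero    = ≋-refl
  one^ (suc n) = ≋-trans (*-identityˡ (one ^P n)) (one^ n)

  C-linear : ∀ {p} x → Mon p 1 → C p x ≋ p ⊛ x ⊕ x ^P q
  C-linear {p} x P = begin
    C p x                                    ≈⟨ C-congˡ x p≋ ⟩
    C (a ∷ one) x                            ≈⟨ C-∷ a one x ⟩
    a · x ⊕ CT (1# · x ⊕ [])
      ≈⟨ +-cong (≋-sym (const-* a x)) (CT-cong (≋-trans (+-identityʳ (1# · x)) (·-identity x))) ⟩
    const a ⊛ x ⊕ (T ⊛ x ⊕ x ^P q)
      ≈⟨ solve 4 (λ a x t y → a :* x :+ (t :* x :+ y) := (a :+ t :* :1) :* x :+ y) ≋-refl (const a) x T (x ^P q) ⟩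
    (const a ⊕ T ⊛ one) ⊛ x ⊕ x ^P q         ≈⟨ +-congʳ (*-congʳ {x} (≋-trans p≋ (∷-split a one))) ⟨
    p ⊛ x ⊕ x ^P q                           ∎
    where
    a : Carrier
    a = coeff p 0
    p≋ : p ≋ a ∷ one
    p≋ = mk λ { zero → refl ; (suc zero) → leading P ; (suc (suc i)) → vanish (bound (deg P)) (suc (suc i)) (s≤s (s≤s z≤n)) }

  C-linear-one : ∀ {p u} → Mon p 1 → u ≋ one → C p u ≋ p ⊕ one
  C-linear-one {p} {u} P u≋1 = ≋-trans (C-congʳ p u≋1) (≋-trans (C-linear one P) (+-cong (*-identityʳ p) (one^ q)))

  Mon-+one : ∀ {p} → Mon p 1 → Mon (p ⊕ one) 1
  Mon-+one P with Deg-+ (deg P) (bound Deg-one)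
  ... | D , top = mkM D (trans top (leading P))

  Exceptional : Pol → Pol → Set
  Exceptional m u = (q ≡ 4) × (u ≈ one) × Σ Pol (λ ℘ → MonicPrime ℘ × Monic ℘ 1 × (m ≈ (℘ - one) ⊛ ℘))

  -- C_m(1) = (p + 1)² p² for m = (p - 1) p, while p + 1 = C_p(1) and p = C_{p+1}(1).
  exceptional⇒¬zsigmondy : ∀ {m u dm} → Mon m dm → Exceptional m u → ∀ {℘} → ¬ Zsigmondy u m dm ℘
  exceptional⇒¬zsigmondy {m} {u} {dm} M (q≡4 , u≈1 , p , _ , P₁ , m≈) {℘} ((_ , ℘-prime) , ℘∣cm , new) =
    [ divides-p+1 , divides-p+1 ]′ (split (p ⊕ one) (p ⊕ one)
      ([ (λ h → h) , ⊥-elim ∘ [ divides-p , divides-p ]′ ∘ split p p ]′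
        (split _ _ (∣-respʳ cm≋ (∣-fromDefs ℘∣cm)))))
    where
    P : Mon p 1
    P = Monic⇒Mon P₁

    split : ∀ a b → ℘ ∣ a ⊛ b → ℘ ∣ a ⊎ ℘ ∣ b
    split a b d = [ inj₁ ∘ ∣-fromDefs , inj₂ ∘ ∣-fromDefs ]′ (℘-prime a b (∣-toDefs d))

    m≋ : m ≋ (p ⊕ one) ⊛ p
    m≋ = ≋-trans (mk m≈) (solve 1 (λ p → (p :+ (:- :1)) :* p := (p :+ :1) :* p) ≋-refl p)

    1<dm : 1 < dm
    1<dm = ℕₚ.≤-reflexive (Deg-unique (Deg-cong (≋-sym m≋) (Deg-* (deg (Mon-+one P)) (deg P))) (deg M))

    fourth : ∀ x → x ^P q ≋ x ⊛ x ⊛ (x ⊛ x)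
    fourth x = subst (λ n → x ^P n ≋ x ⊛ x ⊛ (x ⊛ x)) (sym q≡4)
      (solve 1 (λ x → x :* (x :* (x :* (x :* :1))) := x :* x :* (x :* x)) ≋-refl x)

    cm≋ : C m u ≋ ((p ⊕ one) ⊛ (p ⊕ one)) ⊛ (p ⊛ p)
    cm≋ = begin
      C m u                                       ≈⟨ C-congˡ u m≋ ⟩
      C ((p ⊕ one) ⊛ p) u                         ≈⟨ C-* (p ⊕ one) p u ⟩
      C (p ⊕ one) (C p u)                         ≈⟨ C-congʳ (p ⊕ one) (C-linear-one P (mk u≈1)) ⟩
      C (p ⊕ one) (p ⊕ one)                       ≈⟨ C-linear (p ⊕ one) (Mon-+one P) ⟩
      (p ⊕ one) ⊛ (p ⊕ one) ⊕ (p ⊕ one) ^P q      ≈⟨ +-congˡ {(p ⊕ one) ⊛ (p ⊕ one)} (fourth (p ⊕ one)) ⟩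
      (p ⊕ one) ⊛ (p ⊕ one) ⊕ (p ⊕ one) ⊛ (p ⊕ one) ⊛ ((p ⊕ one) ⊛ (p ⊕ one))
        ≈⟨ solve 1 (λ p → (p :+ :1) :* (p :+ :1) :+ (p :+ :1) :* (p :+ :1) :* ((p :+ :1) :* (p :+ :1))
             := ((p :+ :1) :* (p :+ :1)) :* (p :* p)) ≋-refl p ⟩
      ((p ⊕ one) ⊛ (p ⊕ one)) ⊛ (p ⊛ p)           ∎

    divides-p+1 : ¬ ℘ ∣ p ⊕ one
    divides-p+1 d = new p 1 (Deg⇒HasDegree (deg P)) 1<dm
      (∣-toDefs (∣-respʳ (≋-sym (C-linear-one P (mk u≈1))) d))

    divides-p : ¬ ℘ ∣ p
    divides-p d = new (p ⊕ one) 1 (Deg⇒HasDegree (deg (Mon-+one P))) 1<dm (∣-toDefs (∣-respʳ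
      (≋-sym (≋-trans (C-linear-one (Mon-+one P) (mk u≈1)) (solve 1 (λ p → p :+ :1 :+ :1 := p) ≋-refl p))) d))

  n<q*n : ∀ {n} → 0 < n → n < q * n
  n<q*n {n} 0<n = subst (n <_) (ℕₚ.*-comm n q)
    (ℕₚ.m<m*n n q ⦃ ℕ.>-nonZero 0<n ⦄ (ℕₚ.<-trans (s≤s (s≤s z≤n)) 2<q))

  -- Here δ is geometric from 0 on, so the degree of the primitive part is at least φ, which exceeds
  -- the total degree of the primes of m.
  exists-positive : ∀ {m u dm du} → Mon m dm → Mon u (suc du) → Σ Pol (Zsigmondy u m dm)
  exists-positive {m} {u} {dm} {du} M U =
    Existence.exists M fac (primitiveDegree-positive δ 0 (suc du) (s≤s z≤n) (λ _ → refl) (PrimeFactors.cofactor-degree fac) (degrees (PrimeFactors.primes-prime fac)))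
    where
    fac : PrimeFactors m
    fac = primeFactors M
    δ : ℕ → ℕ
    δ i = q ^ i * suc du
    0<δ : ∀ i → 0 < δ i
    0<δ i = ℕₚ.*-mono-≤ {1} {q ^ i} {1} {suc du} (ℕₚ.m^n>0 q ⦃ ℕ.>-nonZero (ℕₚ.<-trans (s≤s z≤n) 2<q) ⦄ i) (s≤s z≤n)
    iter : ∀ i → Deg (CTiter i u) (δ i)
    iter zero    = subst (Deg u) (sym (ℕₚ.*-identityˡ (suc du))) (deg U)
    iter (suc i) = subst (Deg (CTiter (suc i) u)) (sym (ℕₚ.*-assoc q (q ^ i) (suc du))) (CT-Deg (0<δ i) (iter i))
    mono : ∀ i → δ i < δ (suc i)
    mono i = subst (δ i <_) (sym (ℕₚ.*-assoc q (q ^ i) (suc du))) (n<q*n (0<δ i))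
    open Sequence u δ iter mono

  module UnitCase {u : Pol} (u≋1 : u ≋ one) where
    -- In C_T(1) = T + 1 the linear term dominates, so the first step raises the degree from 0 to 1;
    -- every later step multiplies it by q.
    δ : ℕ → ℕ
    δ zero    = 0
    δ (suc i) = q ^ i * 1

    0<δ : ∀ i → 0 < δ (suc i)
    0<δ i = ℕₚ.*-monoˡ-≤ 1 (ℕₚ.m^n>0 q ⦃ ℕ.>-nonZero (ℕₚ.<-trans (s≤s z≤n) 2<q) ⦄ i)

    U : Deg u 0
    U = Deg-cong (≋-sym u≋1) Deg-one

    iter : ∀ i → Deg (CTiter i u) (δ i)
    iter zero          = U
    iter (suc zero)    = proj₁ (Deg-+ (Deg-* Deg-T U) (bound (subst (Deg (u ^P q)) (ℕₚ.*-zeroʳ q) (Deg-^ q U))))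
    iter (suc (suc i)) = subst (Deg (CTiter (2 + i) u)) (sym (ℕₚ.*-assoc q (q ^ i) 1)) (CT-Deg (0<δ i) (iter (suc i)))

    mono : ∀ i → δ i < δ (suc i)
    mono zero    = s≤s z≤n
    mono (suc i) = subst (δ (suc i) <_) (sym (ℕₚ.*-assoc q (q ^ i) 1)) (n<q*n (0<δ i))

    open Sequence u δ iter mono

    module _ {m : Pol} {dm : ℕ} (M : Mon m dm) (0<dm : 0 < dm) (¬exc : ¬ Exceptional m u) where

      module _ (fac : PrimeFactors m) where
        open PrimeFactors fac
        open Existence M fac

        R-Deg′ : ∀ {κ ds} → cofactor-degree ≡ κ → degrees primes-prime ≡ ds → Deg R (primitiveDegree δ κ ds)
        R-Deg′ κ≡ ds≡ = subst₂ (λ κ ds → Deg R (primitiveDegree δ κ ds)) κ≡ ds≡ R-Deg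

        -- Now m is itself a linear prime and m/p is a nonzero constant, as is c(m/p). No prime is
        -- intrinsic, so deg R = 1 suffices with no prime to peel off.
        one-linear-prime : cofactor-degree ≡ 0 → degrees primes-prime ≡ 0 ∷ [] → Goal
        one-linear-prime κ≡0 ds≡ = peel [] [] ∣-refl (R-Deg′ κ≡0 ds≡) (s≤s z≤n)
          λ {℘} P ℘∣R → inj₁ (℘ , zsigmondy P ℘∣R (All.map (not-intrinsic P) primes-prime))
          where
          dm≡1 : dm ≡ 1
          dm≡1 = trans dm≡ (cong₂ _+_ κ≡0 (cong totalDegree ds≡))
          not-intrinsic : ∀ {℘ p} → PrimeMonic ℘ → PrimeMonic p → NotIntrinsic ℘ p
          not-intrinsic P Q _ n np≋m ℘∣cn with Deg-factors n _ (deg M) (≋-sym np≋m)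
          ... | a , b , N , D , eq with Deg-unique D (deg (monic Q))
          ... | refl with ℕₚ.m+n≡0⇒m≡0 a {degree-1 Q} (ℕₚ.suc-injective (trans (sym (ℕₚ.+-suc a (degree-1 Q))) (trans (sym eq) dm≡1)))
          ... | refl = prime≢unit P ℘∣cn (c-Deg N)

      -- At q = 4, deg R = (4 - 1) - 1 = 2 equals the total degree of the two primes, so `exists`
      -- misses by one. If p₁ does not divide c(p₂), only p₂ has to be peeled off, and 1 < 2.
      -- Otherwise p₁ and p₂ + 1 are monic of degree 1 and therefore equal.
      two-linear-primes : q ≡ 4 → (fac : PrimeFactors m) → PrimeFactors.cofactor-degree fac ≡ 0 →
        degrees (PrimeFactors.primes-prime fac) ≡ 0 ∷ 0 ∷ [] → Σ Pol (Zsigmondy u m dm)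
      two-linear-primes q≡4 record { primes-prime = [] } _ ()
      two-linear-primes q≡4 record { primes-prime = _ ∷ [] } _ ()
      two-linear-primes q≡4 record { primes-prime = _ ∷ _ ∷ _ ∷ _ } _ ()
      two-linear-primes q≡4 fac@(record { cofactor = k ; cofactor-monic = K ; primes = p₁ ∷ p₂ ∷ [] ; primes-prime = P₁ ∷ P₂ ∷ [] ; product = product }) κ≡0 ds≡
        = decide (p₁ ∣? c p₂)
        where
        open Existence M fac

        Mon-1 : ∀ {p} (P : PrimeMonic p) → degree-1 P ≡ 0 → Mon p 1
        Mon-1 P eq = subst (λ d → Mon _ (suc d)) eq (monic P)

        m≋p₂p₁ : m ≋ p₂ ⊛ p₁
        m≋p₂p₁ = ≋-trans product (≋-trans (*-congʳ {p₁ ⊛ (p₂ ⊛ one)} (Mon-0 (subst (Mon k) κ≡0 K)))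
          (solve 2 (λ p r → :1 :* (p :* (r :* :1)) := r :* p) ≋-refl p₁ p₂))

        decide : Dec (p₁ ∣ c p₂) → Goal
        decide (no p₁∤) = peel (P₂ ∷ []) (All.tail splits) ∣-refl (R-Deg′ fac κ≡0 ds≡)
            (subst₂ (λ d t → suc d + 0 < t ^ 1 * 1 ∸ 1 ∸ 1) (sym deg₂) (sym q≡4) (s≤s (s≤s z≤n)))
            λ {℘} P ℘∣R → choose P ℘∣R (℘ ∣? p₂)
          where
          deg₂ : degree-1 P₂ ≡ 0
          deg₂ = cong (λ { (_ ∷ d ∷ _) → d ; _ → 0 }) ds≡

          choose : ∀ {℘} → PrimeMonic ℘ → ℘ ∣ R → Dec (℘ ∣ p₂) → Goal ⊎ Any (℘ ∣_) (p₂ ∷ [])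
          choose P ℘∣R (yes ℘∣p₂) = inj₂ (here ℘∣p₂)
          choose {℘} P ℘∣R (no ℘∤p₂) = inj₁ (℘ , zsigmondy P ℘∣R
            ((λ ℘∣p₁ n np₁≋m ℘∣cn → p₁∤ (∣-respˡ (prime∣prime⇒≋ P P₁ ℘∣p₁)
                (∣-respʳ (c-cong {n} {p₂} (cofactor-unique np₁≋m (≋-sym m≋p₂p₁))) ℘∣cn))) ∷
             (λ ℘∣p₂ → ⊥-elim (℘∤p₂ ℘∣p₂)) ∷ []))
        decide (yes p₁∣) = ⊥-elim (¬exc (q≡4 , at u≋1 , p₂ , PrimeMonic⇒MonicPrime P₂ , Mon⇒Monic M₂ , at m≋))
          where
          M₁ : Mon p₁ 1
          M₁ = Mon-1 P₁ (cong (λ { (d ∷ _) → d ; _ → 0 }) ds≡)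
          M₂ : Mon p₂ 1
          M₂ = Mon-1 P₂ (cong (λ { (_ ∷ d ∷ _) → d ; _ → 0 }) ds≡)

          p₂+1≋p₁ : p₂ ⊕ one ≋ p₁
          p₂+1≋p₁ with ∣-respʳ (C-linear-one M₂ u≋1) p₁∣
          ... | x , eq with Mon-cofactor x (Mon-+one M₂) M₁ eq
          ... | zero , X , _ = ≋-trans eq (≋-trans (*-congˡ p₁ (Mon-0 X)) (*-identityʳ p₁))

          m≋ : m ≋ (p₂ - one) ⊛ p₂
          m≋ = ≋-trans m≋p₂p₁ (≋-trans (*-congˡ p₂ (≋-sym p₂+1≋p₁))
            (solve 1 (λ p → p :* (p :+ :1) := (p :+ (:- :1)) :* p) ≋-refl p₂))

      exists-unit : Σ Pol (Zsigmondy u m dm)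
      -- The degrees are abstracted to variables first, so that the equations from `classify` can be
      -- matched with `refl`.
      exists-unit = go _ _ refl refl
        where
        fac : PrimeFactors m
        fac = primeFactors M
        open PrimeFactors fac
        open Existence M fac

        enough : ∀ {κ ds} → cofactor-degree ≡ κ → degrees primes-prime ≡ ds → totalDegree ds < primitiveDegree δ κ ds → Goal
        enough κ≡ ds≡ = exists ∘ subst₂ (λ κ ds → totalDegree ds < primitiveDegree δ κ ds) (sym κ≡) (sym ds≡)

        large : ∀ {ds} → cofactor-degree ≡ 0 → degrees primes-prime ≡ ds → Large ds → Goal
        large {ds} κ≡0 ds≡ h = enough κ≡0 ds≡ (Large⇒totalDegree< δ refl (λ _ → refl) ds h)

        go : ∀ κ ds → cofactor-degree ≡ κ → degrees primes-prime ≡ ds → Goal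
        -- A cofactor of positive degree keeps every argument of δ at 1 or above, where δ is
        -- geometric.
        go (suc κ) ds κ≡ ds≡ = enough κ≡ ds≡ (primitiveDegree-positive δ 1 1 (s≤s z≤n) (λ _ → refl) κ ds)
        go zero ds κ≡0 ds≡ with classify ds
        ... | inj₁ refl = ⊥-elim (ℕₚ.<⇒≢ 0<dm (sym (trans dm≡ (cong₂ _+_ κ≡0 (cong totalDegree ds≡)))))
        ... | inj₂ (inj₁ refl) = one-linear-prime fac κ≡0 ds≡
        ... | inj₂ (inj₂ (inj₂ h)) = large κ≡0 ds≡ h
        ... | inj₂ (inj₂ (inj₁ refl)) with ℕₚ.m≤n⇒m<n∨m≡n 4≤q
        ...   | inj₁ 5≤q = large κ≡0 ds≡ (Large-11 5≤q)
        ...   | inj₂ 4≡q = two-linear-primes (sym 4≡q) fac κ≡0 ds≡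

theorem5p2 : (e q : ℕ) → q ≡ 2 ^ e → 2 < q → (F : FiniteField q) →
    let open Poly F in
    (m u : Pol) (dm du : ℕ) → Monic m dm → Monic u du → (0 < dm ⊎ 0 < du) →
    (Σ Pol (λ ℘ → Zsigmondy u m dm ℘))
    ⇔ (¬ ((q ≡ 4) × (u ≈ one)
    × Σ Pol (λ ℘ → MonicPrime ℘ × Monic ℘ 1 × (m ≈ (℘ - one) * ℘))))
theorem5p2 e q q≡2^e 2<q F m u dm du M U 0<dm⊎0<du =
  mk⇔ (λ (℘ , z) exc → exceptional⇒¬zsigmondy {m} (Monic⇒Mon M) exc {℘} z) (existence du (Monic⇒Mon U) 0<dm⊎0<du)
  where
  open Cases F (FieldTheory.char2 F e q≡2^e) e q≡2^e 2<q
  open Degree F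
  open Poly F using (Pol; Zsigmondy)

  existence : ∀ du → Mon u du → 0 < dm ⊎ 0 < du → ¬ Exceptional m u → Σ Pol (Zsigmondy u m dm)
  existence (suc du) U′ _             _    = exists-positive {m} (Monic⇒Mon M) U′
  existence zero     U′ (inj₁ 0<dm)   ¬exc = UnitCase.exists-unit (Mon-0 U′) {m} (Monic⇒Mon M) 0<dm ¬exc
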